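{- Let $n\ge 4$ be an integer with $n\equiv 3,5,7,9,11$ or $13 \pmod{14}$. Then there exists a configuration $(2,4)$ $GDD\left(n,2,6;7n,8(n-1)\right)$.
   Context: A $GDD(n,2,6;\lambda_1,\lambda_2)$ is a finite collection (repetitions allowed) of $6$-element subsets, called blocks, of a $2n$-element set $X$ partitioned into two groups of size $n$, such that every point lies in the same number $r$ of blocks, any two distinct points of the same group lie together in exactly $\lambda_1$ blocks, and any two points from different groups lie together in exactly $\lambda_2$ blocks. It has configuration $(2,4)$ if every block has exactly $2$ points in one of the two groups and $4$ points in the other (which group contains the $2$ points may depend on the block). -}

module Defs where

open import Data.Fin.Base using (Fin)
open import Data.Fin.Properties using (_≟_)
open import Data.Fin.Subset using (Subset; _∩_; ∣_∣)
open import Data.Fin.Subset.Properties using (_∈?_)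
open import Data.List.Base using (List; filter; length)
open import Data.List.Relation.Unary.All using (All)
open import Data.Nat.Base using (ℕ; _*_)
open import Data.Product.Base using (_×_; ∃₂)
open import Data.Vec.Base using (tabulate)
open import Relation.Binary.PropositionalEquality using (_≡_; _≢_)
open import Relation.Nullary.Decidable using (does; _×-dec_)

-- A collection of blocks is a list of subsets, so repeated blocks are counted
-- with multiplicity; the order of the list plays no role.

#∋ : ∀ {v} → List (Subset v) → Fin v → ℕ
#∋ 𝓑 x = length (filter (λ B → x ∈? B) 𝓑)

#∋₂ : ∀ {v} → List (Subset v) → Fin v → Fin v → ℕ
#∋₂ 𝓑 x y = length (filter (λ B → (x ∈? B) ×-dec (y ∈? B)) 𝓑)

fibre : ∀ {v m} → (Fin v → Fin m) → Fin m → Subset v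
fibre f i = tabulate (λ x → does (f x ≟ i))

-- GDD(n, m, k; λ₁, λ₂).  The point set is Fin (m * n), and the partition into
-- m groups of size n is given by the map sending each point to its group.

record GDD (n m k λ₁ λ₂ : ℕ) : Set where
  field
    groupOf         : Fin (m * n) → Fin m
    blocks          : List (Subset (m * n))
    r               : ℕ
    group-size      : ∀ i → ∣ fibre groupOf i ∣ ≡ n
    block-size      : All (λ B → ∣ B ∣ ≡ k) blocks
    replication     : ∀ x → #∋ blocks x ≡ r
    same-group      : ∀ x y → x ≢ y → groupOf x ≡ groupOf y →
                      #∋₂ blocks x y ≡ λ₁
    different-group : ∀ x y → groupOf x ≢ groupOf y →
                      #∋₂ blocks x y ≡ λ₂

  group : Fin m → Subset (m * n)
  group = fibre groupOf

-- The pair of groups (i , j) is chosen separately for each block.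

HasConfiguration : ∀ {n k λ₁ λ₂} → ℕ → ℕ → GDD n 2 k λ₁ λ₂ → Set
HasConfiguration s t D =
  All (λ B → ∃₂ λ i j → i ≢ j × ∣ B ∩ group i ∣ ≡ s × ∣ B ∩ group j ∣ ≡ t) blocks
  where open GDD D

{-# OPTIONS --safe #-}

-- Let n = 2h + 1 and identify both groups with ℤ/n.  Suppose we have h pairs
-- (E , Q) of a 2-set and a 4-set in ℤ/n whose 7h differences cover every class
-- {d , −d} of nonzero residues exactly seven times.  Put E + a into one group
-- and Q + b into the other, for all translations a, b and both choices of the
-- group receiving E.  Since a and b are independent, every mixed pair is covered
-- 2 · 4 + 4 · 2 times for each (E , Q), that is 16h = 8(n − 1) times, and a pair
-- inside a group is covered 7n times.
--
-- If 3 ∤ n, take E = {0, i} and Q = {0, i, 2i, 3i} for 1 ≤ i ≤ h.  If 3 ∣ n, the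
-- sets {0, 1, 2, 3} and {0, i, 2i, 3i − 1}, 2 ≤ i ≤ h, cover each class at most
-- seven times, and the 2-sets fill the deficit.
--
-- A multiset of differences is tested against an arbitrary even n-periodic
-- function g on ℕ; equalities between such multisets then become reindexings
-- of sums.

module Submission where

open import Algebra.Properties.CommutativeSemigroup using (interchange)
open import Data.Bool.Base using (Bool; true; false; _∧_; if_then_else_)
open import Data.Bool.ListAction using (any)
open import Data.Fin.Base using (Fin; zero; suc; toℕ; combine; remQuot; _↑ˡ_; _↑ʳ_)
open import Data.Fin.Properties using (toℕ<n; toℕ-injective; remQuot-combine; combine-remQuot)
  renaming (_≟_ to _≟ᶠ_)
open import Data.Fin.Subset using (Subset; _∩_; ∣_∣)
open import Data.Fin.Subset.Properties using (_∈?_)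
open import Data.List.Base
  using (List; _∷_; []; _++_; applyDownFrom; concat; concatMap; filter; length; map; zip)
open import Data.List.Membership.Propositional using (_∈_)
open import Data.List.Properties
  using (map-∘; map-cong; map-++; map-applyDownFrom; length-map; length-++;
         length-applyDownFrom; length-zipWith)
open import Data.List.Relation.Unary.All as All using (All; _∷_; [])
open import Data.List.Relation.Unary.All.Properties
  using (applyDownFrom⁺₁; applyDownFrom⁺₂; concat⁺; map⁺; ++⁺)
open import Data.List.Relation.Unary.AllPairs using (AllPairs; _∷_; [])
open import Data.Nat.Base
open import Data.Nat.DivMod
open import Data.Nat.Divisibility using (_∣_; _∤_; divides; >⇒∤)
open import Data.Nat.ListAction using (sum)
open import Data.Nat.ListAction.Properties using (sum-++)
open import Data.Nat.Properties
open import Data.Nat.Tactic.RingSolver using (solve-∀)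
open import Data.Product.Base using (_×_; _,_; ∃; proj₁; proj₂; uncurry)
open import Data.Sum.Base using (inj₁; inj₂)
open import Data.Vec.Base using (lookup; tabulate; []; _∷_)
open import Data.Vec.Properties using (lookup∘tabulate; tabulate-cong)
open import Function.Base using (_∘_)
open import Relation.Binary.PropositionalEquality
open import Relation.Nullary.Decidable using (does; dec-false; yes; no; _×-dec_)
open import Relation.Nullary.Negation using (contradiction)
open import Relation.Unary using (Decidable)
open import Defs

-- Finite sums and their reindexing.

-- `applyDownFrom` lists the largest index first, so peeling off the last term is definitional;
-- `∑-first` works at the other end.
∑ : ℕ → (ℕ → ℕ) → ℕ
∑ n f = sum (applyDownFrom f n)

∑-cong : ∀ n {f g} → (∀ i → i < n → f i ≡ g i) → ∑ n f ≡ ∑ n g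
∑-cong zero    f≗g = refl
∑-cong (suc n) f≗g = cong₂ _+_ (f≗g n ≤-refl) (∑-cong n (λ i i<n → f≗g i (m≤n⇒m≤1+n i<n)))

∑-ext : ∀ n {f g} → f ≗ g → ∑ n f ≡ ∑ n g
∑-ext n f≗g = ∑-cong n (λ i _ → f≗g i)

∑-const : ∀ n c → ∑ n (λ _ → c) ≡ n * c
∑-const zero    c = refl
∑-const (suc n) c = cong (c +_) (∑-const n c)

∑-zero : ∀ n → ∑ n (λ _ → 0) ≡ 0
∑-zero n = trans (∑-const n 0) (*-zeroʳ n)

∑-+ : ∀ n f g → ∑ n (λ i → f i + g i) ≡ ∑ n f + ∑ n g
∑-+ zero    f g = refl
∑-+ (suc n) f g rewrite ∑-+ n f g = interchange +-commutativeSemigroup (f n) (g n) (∑ n f) (∑ n g)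

∑-*ˡ : ∀ n c f → ∑ n (λ i → c * f i) ≡ c * ∑ n f
∑-*ˡ zero    c f = sym (*-zeroʳ c)
∑-*ˡ (suc n) c f rewrite ∑-*ˡ n c f = sym (*-distribˡ-+ c (f n) (∑ n f))

∑-*ʳ : ∀ n c f → ∑ n (λ i → f i * c) ≡ ∑ n f * c
∑-*ʳ zero    c f = refl
∑-*ʳ (suc n) c f rewrite ∑-*ʳ n c f = sym (*-distribʳ-+ c (f n) (∑ n f))

∑-swap : ∀ m n (f : ℕ → ℕ → ℕ) → ∑ m (λ i → ∑ n (f i)) ≡ ∑ n (λ j → ∑ m (λ i → f i j))
∑-swap zero    n f = sym (∑-zero n)
∑-swap (suc m) n f rewrite ∑-swap m n f = sym (∑-+ n (f m) (λ j → ∑ m (λ i → f i j)))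

∑-first : ∀ n f → ∑ (suc n) f ≡ f 0 + ∑ n (f ∘ suc)
∑-first zero    f = refl
∑-first (suc n) f rewrite ∑-first n f = swap (f (suc n)) (f 0) (∑ n (f ∘ suc))
  where
  swap : ∀ a b c → a + (b + c) ≡ b + (a + c)
  swap = solve-∀

∑-split : ∀ m k f → ∑ (m + k) f ≡ ∑ m (λ i → f (i + k)) + ∑ k f
∑-split zero    k f = refl
∑-split (suc m) k f rewrite ∑-split m k f =
  sym (+-assoc (f (m + k)) (∑ m (λ i → f (i + k))) (∑ k f))

-- Relating the indices by `suc (i + j) ≡ n` avoids truncated subtraction: matching on the equation
-- eliminates `n` and leaves a ring identity.
∑-reflect : ∀ n {f g} → (∀ i j → suc (i + j) ≡ n → f i ≡ g j) → ∑ n f ≡ ∑ n g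
∑-reflect zero    f~g = refl
∑-reflect (suc n) {f} {g} f~g = begin
  f n + ∑ n f          ≡⟨ cong₂ _+_ (f~g n 0 (cong suc (+-identityʳ n)))
                            (∑-reflect n (λ i j eq → f~g i (suc j) (cong suc (trans (+-suc i j) eq)))) ⟩
  g 0 + ∑ n (g ∘ suc)  ≡⟨ ∑-first n g ⟨
  ∑ (suc n) g          ∎
  where open ≡-Reasoning

∑-pairs : ∀ h f → ∑ (h * 2) f ≡ ∑ h (λ i → f (i * 2)) + ∑ h (λ i → f (suc (i * 2)))
∑-pairs zero    f = refl
∑-pairs (suc h) f rewrite ∑-pairs h f =
  rearrange (f (suc (h * 2))) (f (h * 2)) (∑ h (λ i → f (i * 2))) (∑ h (λ i → f (suc (i * 2))))
  where
  rearrange : ∀ a b c d → a + (b + (c + d)) ≡ (b + c) + (a + d)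
  rearrange = solve-∀

∑-triples : ∀ m f → ∑ (m * 3) f ≡
  ∑ m (λ i → f (i * 3)) + ∑ m (λ i → f (1 + i * 3)) + ∑ m (λ i → f (2 + i * 3))
∑-triples zero    f = refl
∑-triples (suc m) f rewrite ∑-triples m f =
  rearrange (f (2 + m * 3)) (f (1 + m * 3)) (f (m * 3))
    (∑ m (λ i → f (i * 3))) (∑ m (λ i → f (1 + i * 3))) (∑ m (λ i → f (2 + i * 3)))
  where
  rearrange : ∀ a b c x y z → a + (b + (c + ((x + y) + z))) ≡ ((c + x) + (b + y)) + (a + z)
  rearrange = solve-∀

-- Moving the window by one exchanges the term at `q` for the term at `q + n`, equal by periodicity.
-- Adding `f q` to both sides takes the place of a subtraction.
∑-shift : ∀ n f → (∀ a → f (n + a) ≡ f a) → ∀ q → ∑ n (λ a → f (q + a)) ≡ ∑ n f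
∑-shift n f per zero    = refl
∑-shift n f per (suc q) = trans (+-cancelˡ-≡ (f q) _ _ step) (∑-shift n f per q)
  where
  open ≡-Reasoning
  step : f q + ∑ n (λ a → f (suc q + a)) ≡ f q + ∑ n (λ a → f (q + a))
  step = begin
    f q + ∑ n (λ a → f (suc q + a))
      ≡⟨ cong₂ _+_ (cong f (sym (+-identityʳ q)))
           (∑-ext n (λ a → cong f (sym (+-suc q a)))) ⟩
    f (q + 0) + ∑ n (λ a → f (q + suc a))    ≡⟨ ∑-first n (λ a → f (q + a)) ⟨
    f (q + n) + ∑ n (λ a → f (q + a))        ≡⟨ cong (_+ ∑ n (λ a → f (q + a)))
                                                  (trans (cong f (+-comm q n)) (per q)) ⟩
    f q + ∑ n (λ a → f (q + a))              ∎

-- Even periodic functions and residues up to sign.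

-- A single condition, free of subtraction, for both properties: `y` is minus `z` modulo `n`, and
-- two negations make a translation by a multiple of `n`.
EvenPeriodic : ℕ → (ℕ → ℕ) → Set
EvenPeriodic n g = ∀ k {y z} → y + z ≡ k * n → g y ≡ g z

-- `z * m` represents minus `z` modulo `suc m`; evenness is used once to reach it and once to
-- return.
periodic : ∀ m {g} → EvenPeriodic (suc m) g → ∀ k z → g (k * suc m + z) ≡ g z
periodic m {g} even k z = trans (even (k + z) {z = z * m} (sum₁ k z m)) (even z (sum₂ z m))
  where
  sum₁ : ∀ k z m → k * suc m + z + z * m ≡ (k + z) * suc m
  sum₁ = solve-∀
  sum₂ : ∀ z m → z * m + z ≡ z * suc m
  sum₂ = solve-∀

+-double-injective : ∀ {a b} → a + a ≡ b + b → a ≡ b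
+-double-injective {a} {b} eq = *-cancelˡ-≡ a b 2
  (trans (cong (a +_) (+-identityʳ a)) (trans eq (cong (b +_) (sym (+-identityʳ b)))))

module OddModulus (h : ℕ) (g : ℕ → ℕ) (even : EvenPeriodic (suc (h * 2)) g) where

  open ≡-Reasoning

  -- Negation maps the upper half h + 1, ..., 2h onto 1, ..., h in reverse order.
  ∑-all-residues : ∑ (h * 2) (g ∘ suc) ≡ ∑ h (g ∘ suc) + ∑ h (g ∘ suc)
  ∑-all-residues = begin
    ∑ (h * 2) (g ∘ suc)                             ≡⟨ cong (λ k → ∑ k (g ∘ suc)) (h*2 h) ⟩
    ∑ (h + h) (g ∘ suc)                             ≡⟨ ∑-split h h (g ∘ suc) ⟩
    ∑ h (λ i → g (suc (i + h))) + ∑ h (g ∘ suc)     ≡⟨ cong (_+ ∑ h (g ∘ suc)) (∑-reflect h λ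
                                                         { i j refl → even 1 (mirror i j) }) ⟩
    ∑ h (g ∘ suc) + ∑ h (g ∘ suc)                   ∎
    where
    h*2 : ∀ h → h * 2 ≡ h + h
    h*2 = solve-∀
    mirror : ∀ i j → suc (i + suc (i + j)) + suc j ≡ 1 * suc (suc (i + j) * 2)
    mirror = solve-∀

  -- As the modulus is odd, negation exchanges the odd and the even numbers among 1, ..., 2h, so
  -- each kind carries half of the total.
  ∑-odds : ∑ h (λ i → g (suc (i * 2))) ≡ ∑ h (g ∘ suc)
  ∑-odds = +-double-injective (begin
    ∑ h (λ i → g (suc (i * 2))) + ∑ h (λ i → g (suc (i * 2)))
      ≡⟨ cong (∑ h (λ i → g (suc (i * 2))) +_) (∑-reflect h λ { i j refl → even 1 (mirror i j) }) ⟩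
    ∑ h (λ i → g (suc (i * 2))) + ∑ h (λ i → g (suc (suc (i * 2))))
      ≡⟨ ∑-pairs h (g ∘ suc) ⟨
    ∑ (h * 2) (g ∘ suc)
      ≡⟨ ∑-all-residues ⟩
    ∑ h (g ∘ suc) + ∑ h (g ∘ suc) ∎)
    where
    mirror : ∀ i j → suc (i * 2) + suc (suc (j * 2)) ≡ 1 * suc (suc (i + j) * 2)
    mirror = solve-∀

  -- The arguments are the doubles of 1, ..., h: this is the statement that doubling permutes the
  -- classes up to sign.
  ∑-evens : ∑ h (λ i → g (suc (suc (i * 2)))) ≡ ∑ h (g ∘ suc)
  ∑-evens = +-cancelˡ-≡ (∑ h (g ∘ suc)) _ _ (begin
    ∑ h (g ∘ suc) + ∑ h (λ i → g (suc (suc (i * 2))))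
      ≡⟨ cong (_+ ∑ h (λ i → g (suc (suc (i * 2))))) ∑-odds ⟨
    ∑ h (λ i → g (suc (i * 2))) + ∑ h (λ i → g (suc (suc (i * 2))))
      ≡⟨ ∑-pairs h (g ∘ suc) ⟨
    ∑ (h * 2) (g ∘ suc)
      ≡⟨ ∑-all-residues ⟩
    ∑ h (g ∘ suc) + ∑ h (g ∘ suc) ∎)

-- Lists of residues, their differences, and indicators.

-- The multiset of differences of a list, tested against `g`. For even `g` the absolute difference
-- stands for both signs.
pairSum : (ℕ → ℕ) → List ℕ → ℕ
pairSum g []      = 0
pairSum g (q ∷ L) = sum (map (λ q′ → g ∣ q - q′ ∣) L) + pairSum g L

Distinct : ℕ → List ℕ → Set
Distinct n = AllPairs (λ q q′ → n ∤ ∣ q - q′ ∣)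

bit : Bool → ℕ
bit true  = 1
bit false = 0

bit-∧ : ∀ b c → bit (b ∧ c) ≡ bit b * bit c
bit-∧ true  c = sym (+-identityʳ (bit c))
bit-∧ false c = refl

∑-indicator : ∀ {k x} → x < k → ∑ k (λ a → bit (does (a ≟ x))) ≡ 1
∑-indicator {suc k} {zero} _ = trans (∑-first k _) (cong suc (∑-zero k))
∑-indicator {suc k} {suc x} (s<s x<k) = trans (∑-first k _) (∑-indicator x<k)

congruent⇒∣ : ∀ n .{{_ : NonZero n}} m o → m % n ≡ o % n → n ∣ ∣ m - o ∣
congruent⇒∣ n m o eq = divides ∣ m / n - o / n ∣ (begin
  ∣ m - o ∣
    ≡⟨ cong₂ ∣_-_∣ (m≡m%n+[m/n]*n m n) (m≡m%n+[m/n]*n o n) ⟩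
  ∣ m % n + m / n * n - o % n + o / n * n ∣
    ≡⟨ cong (λ r → ∣ r + m / n * n - o % n + o / n * n ∣) eq ⟩
  ∣ o % n + m / n * n - o % n + o / n * n ∣
    ≡⟨ ∣m+n-m+o∣≡∣n-o∣ (o % n) (m / n * n) (o / n * n) ⟩
  ∣ m / n * n - o / n * n ∣
    ≡⟨ *-distribʳ-∣-∣ n (m / n) (o / n) ⟨
  ∣ m / n - o / n ∣ * n ∎)
  where open ≡-Reasoning

-- Translates of a set of residues and the pairs they cover.

module Translates (m : ℕ) where

  open ≡-Reasoning

  n : ℕ
  n = suc m

  hit : ℕ → ℕ → Bool
  hit u x = does (u % n ≟ x)

  δ : ℕ → ℕ → ℕ
  δ u x = bit (hit u x)

  translate : List ℕ → ℕ → ℕ → Bool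
  translate L a x = any (λ q → hit (q + a) x) L

  hits : List ℕ → ℕ → ℕ → ℕ
  hits L a x = sum (map (λ q → δ (q + a) x) L)

  δ-periodic : ∀ k u x → δ (k * n + u) x ≡ δ u x
  δ-periodic k u x = cong (λ r → bit (does (r ≟ x)))
    (trans (cong (_% n) (+-comm (k * n) u)) ([m+kn]%n≡m%n u k n))

  ∑-shift-n : ∀ f → (∀ k a → f (k * n + a) ≡ f a) → ∀ q → ∑ n (λ a → f (q + a)) ≡ ∑ n f
  ∑-shift-n f per = ∑-shift n f
    (λ a → trans (cong (λ r → f (r + a)) (sym (*-identityˡ n))) (per 1 a))

  ∑-δ : ∀ q {x} → x < n → ∑ n (λ a → δ (q + a) x) ≡ 1
  ∑-δ q {x} x<n = begin
    ∑ n (λ a → δ (q + a) x)          ≡⟨ ∑-shift-n (λ a → δ a x) (λ k a → δ-periodic k a x) q ⟩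
    ∑ n (λ a → δ a x)                ≡⟨ ∑-cong n (λ a a<n → cong (λ r → bit (does (r ≟ x))) (m<n⇒m%n≡m a<n)) ⟩
    ∑ n (λ a → bit (does (a ≟ x)))   ≡⟨ ∑-indicator x<n ⟩
    1                                ∎

  hit⇒% : ∀ u x → hit u x ≡ true → u % n ≡ x
  hit⇒% u x eq with u % n ≟ x
  ... | yes u%n≡x = u%n≡x
  ... | no  u%n≢x = contradiction (trans (sym eq) (dec-false (u % n ≟ x) u%n≢x)) λ ()

  hit-unique : ∀ q q′ a x → n ∤ ∣ q - q′ ∣ → hit (q + a) x ≡ true → hit (q′ + a) x ≡ false
  hit-unique q q′ a x n∤ eq = dec-false ((q′ + a) % n ≟ x) λ same →
    n∤ (subst (n ∣_) cancel (congruent⇒∣ n (q + a) (q′ + a) (trans (hit⇒% (q + a) x eq) (sym same))))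
    where
    cancel : ∣ q + a - q′ + a ∣ ≡ ∣ q - q′ ∣
    cancel = trans (cong₂ ∣_-_∣ (+-comm q a) (+-comm q′ a)) (∣m+n-m+o∣≡∣n-o∣ a q q′)

  -- Elements distinct modulo `n` cannot hit the same point under one translation, so the
  -- disjunction has at most one true term and equals the sum.
  bit-translate : ∀ {L} → Distinct n L → ∀ a x → bit (translate L a x) ≡ hits L a x
  bit-translate []               a x = refl
  bit-translate (_∷_ {q} q∉L dL) a x with hit (q + a) x in eq
  ... | true  = cong suc (sym (no-hits q∉L))
    where
    no-hits : ∀ {L} → All (λ q′ → n ∤ ∣ q - q′ ∣) L → hits L a x ≡ 0
    no-hits []                 = refl
    no-hits (_∷_ {q′} n∤ rest) =
      cong₂ _+_ (cong bit (hit-unique q q′ a x n∤ eq)) (no-hits rest)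
  ... | false = bit-translate dL a x

  ∑-hits : ∀ L {x} → x < n → ∑ n (λ a → hits L a x) ≡ length L
  ∑-hits []      x<n = ∑-zero n
  ∑-hits (q ∷ L) {x} x<n = trans (∑-+ n (λ a → δ (q + a) x) (λ a → hits L a x))
    (cong₂ _+_ (∑-δ q x<n) (∑-hits L x<n))

  -- The count dual to `∑-hits`: the translation is fixed and the point varies, which yields the
  -- size of a translate.
  ∑-hits-points : ∀ L a → ∑ n (hits L a) ≡ length L
  ∑-hits-points []      a = ∑-zero n
  ∑-hits-points (q ∷ L) a = trans (∑-+ n (δ (q + a)) (hits L a))
    (cong₂ _+_ (trans (∑-ext n (λ x → cong bit (does-sym ((q + a) % n) x)))
                 (∑-indicator (m%n<n (q + a) n)))
               (∑-hits-points L a))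
    where
    does-sym : ∀ u v → does (u ≟ v) ≡ does (v ≟ u)
    does-sym zero    zero    = refl
    does-sym zero    (suc v) = refl
    does-sym (suc u) zero    = refl
    does-sym (suc u) (suc v) = does-sym u v

  module Pair {x y : ℕ} (x≢y : x ≢ y) where

    δδ≡0 : ∀ u → δ u x * δ u y ≡ 0
    δδ≡0 u with u % n ≟ x
    ... | yes refl = trans (cong (δ u x *_) (cong bit (dec-false (u % n ≟ y) x≢y))) (*-zeroʳ (δ u x))
    ... | no u%n≢x = cong (λ b → bit b * δ u y) (dec-false (u % n ≟ x) u%n≢x)

    separation : ℕ → ℕ → ℕ
    separation z a = δ a x * δ (z + a) y + δ (z + a) x * δ a y

    -- Counts the ways in which a pair at distance `z` can be translated onto the points `x` and
    -- `y`, in either order. This is the test function to which the balance of a difference family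
    -- is later applied.
    coverage : ℕ → ℕ
    coverage z = ∑ n (separation z)

    separation-periodic : ∀ z k a → separation z (k * n + a) ≡ separation z a
    separation-periodic z k a = cong₂ _+_
      (cong₂ _*_ (δ-periodic k a x) (shifted y)) (cong₂ _*_ (shifted x) (δ-periodic k a y))
      where
      swap : ∀ z c a → z + (c + a) ≡ c + (z + a)
      swap = solve-∀
      shifted : ∀ w → δ (z + (k * n + a)) w ≡ δ (z + a) w
      shifted w = trans (cong (λ u → δ u w) (swap z (k * n) a)) (δ-periodic k (z + a) w)

    -- Translating by `w` turns the pair `a`, `z + a` into `w + a`, `a` modulo `n`: a pair at
    -- distance `w` in the opposite order.
    coverage-even : EvenPeriodic n coverage
    coverage-even k {z} {w} z+w≡kn = begin
      ∑ n (separation z)                  ≡⟨ ∑-shift-n (separation z) (separation-periodic z) w ⟨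
      ∑ n (λ a → separation z (w + a))    ≡⟨ ∑-ext n mirror ⟩
      ∑ n (separation w)                  ∎
      where
      assoc : ∀ a p → δ (z + (w + a)) p ≡ δ a p
      assoc a p = trans (cong (λ u → δ u p) (trans (sym (+-assoc z w a)) (cong (_+ a) z+w≡kn)))
        (δ-periodic k a p)
      mirror : ∀ a → separation z (w + a) ≡ separation w a
      mirror a = begin
        δ (w + a) x * δ (z + (w + a)) y + δ (z + (w + a)) x * δ (w + a) y
          ≡⟨ cong₂ (λ s t → δ (w + a) x * s + t * δ (w + a) y) (assoc a y) (assoc a x) ⟩
        δ (w + a) x * δ a y + δ a x * δ (w + a) y
          ≡⟨ +-comm (δ (w + a) x * δ a y) _ ⟩
        δ a x * δ (w + a) y + δ (w + a) x * δ a y ∎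

    -- The smaller offset is absorbed into the translation, so only the difference of the two
    -- offsets survives.
    ∑-crossed : ∀ q q′ → ∑ n (λ a → δ (q + a) x * δ (q′ + a) y + δ (q′ + a) x * δ (q + a) y)
                ≡ coverage ∣ q - q′ ∣
    ∑-crossed q q′ with ≤-total q q′
    ... | inj₁ q≤q′ = begin
      ∑ n (λ a → δ (q + a) x * δ (q′ + a) y + δ (q′ + a) x * δ (q + a) y)
        ≡⟨ ∑-ext n (λ a → cong (λ u → δ (q + a) x * δ u y + δ u x * δ (q + a) y) (rebase a)) ⟩
      ∑ n (λ a → separation (q′ ∸ q) (q + a))
        ≡⟨ ∑-shift-n (separation (q′ ∸ q)) (separation-periodic (q′ ∸ q)) q ⟩
      coverage (q′ ∸ q)
        ≡⟨ cong coverage (m≤n⇒∣m-n∣≡n∸m q≤q′) ⟨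
      coverage ∣ q - q′ ∣ ∎
      where
      rebase : ∀ a → q′ + a ≡ q′ ∸ q + (q + a)
      rebase a = trans (cong (_+ a) (sym (m∸n+n≡m q≤q′))) (+-assoc (q′ ∸ q) q a)
    ... | inj₂ q′≤q = begin
      ∑ n (λ a → δ (q + a) x * δ (q′ + a) y + δ (q′ + a) x * δ (q + a) y)
        ≡⟨ ∑-ext n (λ a → trans (+-comm (δ (q + a) x * δ (q′ + a) y) _)
             (cong (λ u → δ (q′ + a) x * δ u y + δ u x * δ (q′ + a) y) (rebase a))) ⟩
      ∑ n (λ a → separation (q ∸ q′) (q′ + a))
        ≡⟨ ∑-shift-n (separation (q ∸ q′)) (separation-periodic (q ∸ q′)) q′ ⟩
      coverage (q ∸ q′)
        ≡⟨ cong coverage (m≤n⇒∣n-m∣≡n∸m q′≤q) ⟨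
      coverage ∣ q - q′ ∣ ∎
      where
      rebase : ∀ a → q + a ≡ q ∸ q′ + (q′ + a)
      rebase a = trans (cong (_+ a) (sym (m∸n+n≡m q′≤q))) (+-assoc (q ∸ q′) q′ a)

    ∑-hits-one : ∀ q L →
      ∑ n (λ a → δ (q + a) x * hits L a y + hits L a x * δ (q + a) y) ≡
      sum (map (λ q′ → coverage ∣ q - q′ ∣) L)
    ∑-hits-one q []       = trans
      (∑-ext n (λ a → cong (_+ 0) (*-zeroʳ (δ (q + a) x)))) (∑-zero n)
    ∑-hits-one q (q′ ∷ L) = begin
      ∑ n (λ a → δ (q + a) x * (δ (q′ + a) y + hits L a y) + (δ (q′ + a) x + hits L a x) * δ (q + a) y)
        ≡⟨ ∑-ext n (λ a → expand (δ (q + a) x) (δ (q′ + a) y) (hits L a y)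
             (δ (q′ + a) x) (hits L a x) (δ (q + a) y)) ⟩
      ∑ n (λ a → (δ (q + a) x * δ (q′ + a) y + δ (q′ + a) x * δ (q + a) y) +
                 (δ (q + a) x * hits L a y + hits L a x * δ (q + a) y))
        ≡⟨ ∑-+ n
             (λ a → δ (q + a) x * δ (q′ + a) y + δ (q′ + a) x * δ (q + a) y)
             (λ a → δ (q + a) x * hits L a y + hits L a x * δ (q + a) y) ⟩
      ∑ n (λ a → δ (q + a) x * δ (q′ + a) y + δ (q′ + a) x * δ (q + a) y) +
      ∑ n (λ a → δ (q + a) x * hits L a y + hits L a x * δ (q + a) y)
        ≡⟨ cong₂ _+_ (∑-crossed q q′) (∑-hits-one q L) ⟩
      coverage ∣ q - q′ ∣ + sum (map (λ q″ → coverage ∣ q - q″ ∣) L) ∎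
      where
      expand : ∀ a b c d e f → a * (b + c) + (d + e) * f ≡ (a * b + d * f) + (a * c + e * f)
      expand = solve-∀

    -- After expanding the product, the diagonal terms vanish because one residue cannot equal both
    -- `x` and `y`; the cross terms depend on differences alone.
    ∑-hits-pair : ∀ L → ∑ n (λ a → hits L a x * hits L a y) ≡ pairSum coverage L
    ∑-hits-pair []      = ∑-zero n
    ∑-hits-pair (q ∷ L) = begin
      ∑ n (λ a → (δ (q + a) x + hits L a x) * (δ (q + a) y + hits L a y))
        ≡⟨ ∑-ext n (λ a → expand (δ (q + a) x) (hits L a x) (δ (q + a) y) (hits L a y)) ⟩
      ∑ n (λ a → δ (q + a) x * δ (q + a) y + ((δ (q + a) x * hits L a y + hits L a x * δ (q + a) y)
                 + hits L a x * hits L a y))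
        ≡⟨ ∑-ext n (λ a → cong (_+ ((δ (q + a) x * hits L a y + hits L a x * δ (q + a) y)
                 + hits L a x * hits L a y)) (δδ≡0 (q + a))) ⟩
      ∑ n (λ a → (δ (q + a) x * hits L a y + hits L a x * δ (q + a) y) + hits L a x * hits L a y)
        ≡⟨ ∑-+ n
             (λ a → δ (q + a) x * hits L a y + hits L a x * δ (q + a) y)
             (λ a → hits L a x * hits L a y) ⟩
      ∑ n (λ a → δ (q + a) x * hits L a y + hits L a x * δ (q + a) y) +
      ∑ n (λ a → hits L a x * hits L a y)
        ≡⟨ cong₂ _+_ (∑-hits-one q L) (∑-hits-pair L) ⟩
      pairSum coverage (q ∷ L) ∎
      where
      expand : ∀ a b c d → (a + b) * (c + d) ≡ a * c + ((a * d + b * c) + b * d)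
      expand = solve-∀

    -- Double counting of distances and translations: for fixed `a`, the point `z + a` meets each of
    -- `x` and `y` for exactly one `z`. Distance 0 contributes nothing.
    ∑-coverage : x < n → y < n → ∑ m (coverage ∘ suc) ≡ 2
    ∑-coverage x<n y<n = begin
      ∑ m (coverage ∘ suc)
        ≡⟨ cong (_+ ∑ m (coverage ∘ suc)) coverage-0 ⟨
      coverage 0 + ∑ m (coverage ∘ suc)
        ≡⟨ ∑-first m coverage ⟨
      ∑ n (λ z → ∑ n (separation z))
        ≡⟨ ∑-swap n n separation ⟩
      ∑ n (λ a → ∑ n (λ z → separation z a))
        ≡⟨ ∑-ext n each ⟩
      ∑ n (λ a → δ a x + δ a y)
        ≡⟨ ∑-+ n (λ a → δ a x) (λ a → δ a y) ⟩
      ∑ n (λ a → δ a x) + ∑ n (λ a → δ a y)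
        ≡⟨ cong₂ _+_ (∑-δ 0 x<n) (∑-δ 0 y<n) ⟩
      2 ∎
      where
      coverage-0 : coverage 0 ≡ 0
      coverage-0 = trans (∑-ext n (λ a → cong₂ _+_ (δδ≡0 a) (δδ≡0 a)))
        (∑-zero n)
      ∑-δ′ : ∀ a {w} → w < n → ∑ n (λ z → δ (z + a) w) ≡ 1
      ∑-δ′ a {w} w<n = trans (∑-ext n (λ z → cong (λ u → δ u w) (+-comm z a))) (∑-δ a w<n)
      each : ∀ a → ∑ n (λ z → separation z a) ≡ δ a x + δ a y
      each a = begin
        ∑ n (λ z → δ a x * δ (z + a) y + δ (z + a) x * δ a y)
          ≡⟨ ∑-+ n (λ z → δ a x * δ (z + a) y) (λ z → δ (z + a) x * δ a y) ⟩
        ∑ n (λ z → δ a x * δ (z + a) y) + ∑ n (λ z → δ (z + a) x * δ a y)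
          ≡⟨ cong₂ _+_ (∑-*ˡ n (δ a x) (λ z → δ (z + a) y)) (∑-*ʳ n (δ a y) (λ z → δ (z + a) x)) ⟩
        δ a x * ∑ n (λ z → δ (z + a) y) + ∑ n (λ z → δ (z + a) x) * δ a y
          ≡⟨ cong₂ (λ s t → δ a x * s + t * δ a y) (∑-δ′ a y<n) (∑-δ′ a x<n) ⟩
        δ a x * 1 + 1 * δ a y
          ≡⟨ cong₂ _+_ (*-identityʳ (δ a x)) (*-identityˡ (δ a y)) ⟩
        δ a x + δ a y ∎

-- Difference families and the shapes of their members.

-- Only the total of all differences matters, so 2-sets and 4-sets are kept in separate lists and
-- paired arbitrarily later. The sum over `g ∘ suc` visits one representative of each class.
record DifferenceFamily (h : ℕ) : Set where
  n : ℕ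
  n = suc (h * 2)
  field
    Es Qs     : List (List ℕ)
    length-Es : length Es ≡ h
    length-Qs : length Qs ≡ h
    valid-Es  : All (λ E → length E ≡ 2 × Distinct n E) Es
    valid-Qs  : All (λ Q → length Q ≡ 4 × Distinct n Q) Qs
    balanced  : ∀ g → EvenPeriodic n g →
      sum (map (pairSum g) Es) + sum (map (pairSum g) Qs) ≡ 7 * ∑ h (g ∘ suc)

twoSet : ℕ → List ℕ
twoSet e = 0 ∷ e ∷ []

-- Consecutive gaps `u`, `u`, `w`: both {0, i, 2i, 3i} and {0, i, 2i, 3i - 1} have this form, with
-- `w` equal to i or i - 1.
fourSet : ℕ → ℕ → List ℕ
fourSet u w = 0 ∷ u ∷ u + u ∷ u + u + w ∷ []

pairSum-twoSet : ∀ g e → pairSum g (twoSet e) ≡ g e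
pairSum-twoSet g e = trans (+-identityʳ (g e + 0)) (+-identityʳ (g e))

pairSum-fourSet : ∀ g u w → pairSum g (fourSet u w) ≡
  (g u + (g (u + u) + g (u + u + w))) + (g u + g (u + w)) + g w
pairSum-fourSet g u w
  rewrite ∣m-m+n∣≡n u u | +-assoc u u w | ∣m-m+n∣≡n u (u + w) | ∣m+n-m+o∣≡∣n-o∣ u u (u + w) | ∣m-m+n∣≡n u w
  = drop-zeros (g u) (g (u + u)) (g (u + (u + w))) (g (u + w)) (g w)
  where
  drop-zeros : ∀ a b c d e →
    a + (b + (c + 0)) + (a + (d + 0) + (e + 0 + 0)) ≡ (a + (b + c)) + (a + d) + e
  drop-zeros = solve-∀

Distinct-twoSet : ∀ {n e} → n ∤ e → Distinct n (twoSet e)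
Distinct-twoSet n∤e = (n∤e ∷ []) ∷ [] ∷ []

Distinct-fourSet : ∀ {n} u w → n ∤ u → n ∤ w → n ∤ u + u → n ∤ u + w → n ∤ u + u + w →
  Distinct n (fourSet u w)
Distinct-fourSet {n} u w n∤u n∤w n∤u+u n∤u+w n∤u+u+w =
  (n∤u ∷ n∤u+u ∷ n∤u+u+w ∷ []) ∷
  (subst (n ∤_) (sym (∣m-m+n∣≡n u u)) n∤u ∷
   subst (n ∤_) (sym (trans (cong (λ s → ∣ u - s ∣) (+-assoc u u w)) (∣m-m+n∣≡n u (u + w)))) n∤u+w ∷ []) ∷
  (subst (n ∤_) (sym (∣m-m+n∣≡n (u + u) w)) n∤w ∷ []) ∷ [] ∷ []

∑-fourSet-shape : ∀ n a b c d e f →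
  ∑ n (λ i → (a i + (b i + c i)) + (d i + e i) + f i) ≡
  (∑ n a + (∑ n b + ∑ n c)) + (∑ n d + ∑ n e) + ∑ n f
∑-fourSet-shape n a b c d e f = trans (∑-+ n (λ i → (a i + (b i + c i)) + (d i + e i)) f)
  (cong (_+ ∑ n f) (trans (∑-+ n (λ i → a i + (b i + c i)) (λ i → d i + e i))
    (cong₂ _+_ (trans (∑-+ n a (λ i → b i + c i)) (cong (∑ n a +_) (∑-+ n b c))) (∑-+ n d e))))

sum-map-applyDownFrom : ∀ {A : Set} (w : A → ℕ) f n → sum (map w (applyDownFrom f n)) ≡ ∑ n (w ∘ f)
sum-map-applyDownFrom w f n = cong sum (map-applyDownFrom f w n)

sum-map-twoSets : ∀ g es → sum (map (pairSum g) (map twoSet es)) ≡ sum (map g es)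
sum-map-twoSets g es = cong sum (trans (sym (map-∘ es)) (map-cong (pairSum-twoSet g) es))

-- Tripling of residues and the moduli prime to 3.

-- The only multiple of `n` strictly between 0 and 2n is `n` itself, which the residue modulo 3
-- rules out. This serves the largest differences, which may exceed `n`.
∤-mod-3 : ∀ {n z} → 0 < z → z < n + n → n % 3 ≢ z % 3 → n ∤ z
∤-mod-3 0<z z<2n n≢z (divides zero refl) = <-irrefl refl 0<z
∤-mod-3 {n} 0<z z<2n n≢z (divides (suc zero) refl) = n≢z (cong (_% 3) (sym (+-identityʳ n)))
∤-mod-3 {n} 0<z z<2n n≢z (divides (suc (suc q)) refl) =
  <⇒≱ z<2n (subst (n + n ≤_) (+-assoc n n (q * n)) (m≤m+n (n + n) (q * n)))

-- The modulus is 3m + 1. Of the products 3, 6, ..., 3N the first m stay below it, the next m reduce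
-- to 2, 5, ..., and the last m to 1, 4, ....
tripling₁ : ∀ m {N g} → N ≡ m * 3 → EvenPeriodic (suc N) g →
  ∑ N (λ i → g (suc i * 3)) ≡ ∑ N (g ∘ suc)
tripling₁ m {g = g} refl even = begin
  ∑ (m * 3) f
    ≡⟨ cong (λ N → ∑ N f) (thirds m) ⟩
  ∑ (m + (m + m)) f
    ≡⟨ trans (∑-split m (m + m) f) (cong (∑ m (λ i → f (i + (m + m))) +_) (∑-split m m f)) ⟩
  ∑ m (λ i → f (i + (m + m))) + (∑ m (λ i → f (i + m)) + ∑ m f)
    ≡⟨ cong₂ (λ s t → s + (t + ∑ m f))
         (∑-ext m (λ i → trans (cong g (upper i m)) (periodic (m * 3) even 2 (1 + i * 3))))
         (∑-ext m (λ i → trans (cong g (middle i m)) (periodic (m * 3) even 1 (2 + i * 3)))) ⟩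
  ∑ m (λ i → g (1 + i * 3)) + (∑ m (λ i → g (2 + i * 3)) + ∑ m f)
    ≡⟨ +-assoc (∑ m (λ i → g (1 + i * 3))) _ (∑ m f) ⟨
  ∑ m (λ i → g (1 + i * 3)) + ∑ m (λ i → g (2 + i * 3)) + ∑ m f
    ≡⟨ ∑-triples m (g ∘ suc) ⟨
  ∑ (m * 3) (g ∘ suc) ∎
  where
  open ≡-Reasoning
  f = λ i → g (suc i * 3)
  thirds : ∀ m → m * 3 ≡ m + (m + m)
  thirds = solve-∀
  upper : ∀ i m → suc (i + (m + m)) * 3 ≡ 2 * suc (m * 3) + (1 + i * 3)
  upper = solve-∀
  middle : ∀ i m → suc (i + m) * 3 ≡ 1 * suc (m * 3) + (2 + i * 3)
  middle = solve-∀

-- The modulus is 3m + 2. The blocks now have lengths m, m + 1, m, and the middle one reduces to 1,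
-- 4, ..., 3m + 1, the last one to 2, 5, ....
tripling₂ : ∀ m {N g} → N ≡ suc (m * 3) → EvenPeriodic (suc N) g →
  ∑ N (λ i → g (suc i * 3)) ≡ ∑ N (g ∘ suc)
tripling₂ m {g = g} refl even = begin
  ∑ (suc (m * 3)) f
    ≡⟨ cong (λ N → ∑ N f) (thirds m) ⟩
  ∑ (m + (suc m + m)) f
    ≡⟨ trans (∑-split m (suc m + m) f) (cong (∑ m (λ i → f (i + (suc m + m))) +_) (∑-split (suc m) m f)) ⟩
  ∑ m (λ i → f (i + (suc m + m))) + (∑ (suc m) (λ i → f (i + m)) + ∑ m f)
    ≡⟨ cong₂ (λ s t → s + (t + ∑ m f))
         (∑-ext m (λ i → trans (cong g (upper i m)) (periodic (suc (m * 3)) even 2 (2 + i * 3))))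
         (∑-ext (suc m) (λ i → trans (cong g (middle i m)) (periodic (suc (m * 3)) even 1 (1 + i * 3)))) ⟩
  ∑ m (λ i → g (2 + i * 3)) + (g (1 + m * 3) + ∑ m (λ i → g (1 + i * 3)) + ∑ m f)
    ≡⟨ rearrange (∑ m (λ i → g (2 + i * 3))) (g (1 + m * 3)) (∑ m (λ i → g (1 + i * 3))) (∑ m f) ⟩
  g (1 + m * 3) + (∑ m (λ i → g (1 + i * 3)) + ∑ m (λ i → g (2 + i * 3)) + ∑ m f)
    ≡⟨ cong (g (1 + m * 3) +_) (∑-triples m (g ∘ suc)) ⟨
  ∑ (suc (m * 3)) (g ∘ suc) ∎
  where
  open ≡-Reasoning
  f = λ i → g (suc i * 3)
  thirds : ∀ m → suc (m * 3) ≡ m + (suc m + m)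
  thirds = solve-∀
  upper : ∀ i m → suc (i + (suc m + m)) * 3 ≡ 2 * suc (suc (m * 3)) + (2 + i * 3)
  upper = solve-∀
  middle : ∀ i m → suc (i + m) * 3 ≡ 1 * suc (suc (m * 3)) + (1 + i * 3)
  middle = solve-∀
  rearrange : ∀ a b c d → a + (b + c + d) ≡ b + (c + a + d)
  rearrange = solve-∀

-- Doubling and tripling permute the nonzero residues up to sign.
coprimeFamily : ∀ h →
  (∀ {g} → EvenPeriodic (suc (h * 2)) g →
     ∑ (h * 2) (λ i → g (suc i * 3)) ≡ ∑ (h * 2) (g ∘ suc)) →
  suc (h * 2) % 3 ≢ 0 → DifferenceFamily h
coprimeFamily h tripling 3∤n = record
  { Es        = map twoSet (applyDownFrom suc h)
  ; Qs        = applyDownFrom (λ i → fourSet (suc i) (suc i)) h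
  ; length-Es = trans (length-map twoSet (applyDownFrom suc h)) (length-applyDownFrom suc h)
  ; length-Qs = length-applyDownFrom _ h
  ; valid-Es  = map⁺ (applyDownFrom⁺₁ suc h λ i<h → refl , Distinct-twoSet (∤-single i<h))
  ; valid-Qs  = applyDownFrom⁺₁ _ h λ {i} i<h →
      refl , Distinct-fourSet (suc i) (suc i) (∤-single i<h) (∤-single i<h)
               (∤-double i<h) (∤-double i<h) (∤-triple i<h)
  ; balanced  = balance
  }
  where
  n = suc (h * 2)

  twice : ∀ i → suc i + suc i ≡ suc i * 2
  twice = solve-∀

  double<n : ∀ {i} → i < h → suc i + suc i < n
  double<n {i} i<h = s≤s (subst (_≤ h * 2) (sym (twice i)) (*-monoˡ-≤ 2 i<h))

  ∤-double : ∀ {i} → i < h → n ∤ suc i + suc i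
  ∤-double i<h = >⇒∤ (double<n i<h)

  ∤-single : ∀ {i} → i < h → n ∤ suc i
  ∤-single {i} i<h = >⇒∤ (≤-<-trans (m≤m+n (suc i) (suc i)) (double<n i<h))

  ∤-triple : ∀ {i} → i < h → n ∤ suc i + suc i + suc i
  ∤-triple {i} i<h = ∤-mod-3 z<s
    (+-mono-< (double<n i<h) (≤-<-trans (m≤m+n (suc i) (suc i)) (double<n i<h)))
    -- Agreement of `n` with a triple modulo 3 would make 3 divide `n`.
    (λ eq → 3∤n (trans eq (trans (cong (_% 3) (thrice i)) (m*n%n≡0 (suc i) 3))))
    where
    thrice : ∀ i → suc i + suc i + suc i ≡ suc i * 3
    thrice = solve-∀

  balance : ∀ g → EvenPeriodic n g →
    sum (map (pairSum g) (map twoSet (applyDownFrom suc h))) +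
    sum (map (pairSum g) (applyDownFrom (λ i → fourSet (suc i) (suc i)) h)) ≡ 7 * ∑ h (g ∘ suc)
  balance g even = begin
    sum (map (pairSum g) (map twoSet (applyDownFrom suc h))) +
    sum (map (pairSum g) (applyDownFrom (λ i → fourSet (suc i) (suc i)) h))
      ≡⟨ cong₂ _+_ (trans (sum-map-twoSets g (applyDownFrom suc h)) (sum-map-applyDownFrom g suc h))
           (trans (sum-map-applyDownFrom (pairSum g) (λ i → fourSet (suc i) (suc i)) h) (∑-ext h differences)) ⟩
    -- The 4-set has differences i three times, 2i twice and 3i once; the leading `S` comes from the
    -- 2-sets.
    S + ∑ h (λ i → (g (suc i) + (g (suc (suc (i * 2))) + g (suc i * 3)))
                   + (g (suc i) + g (suc (suc (i * 2)))) + g (suc i))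
      ≡⟨ cong (S +_) (∑-fourSet-shape h _ _ (λ i → g (suc i * 3)) _ _ _) ⟩
    S + ((S + (D + T)) + (S + D) + S)
      ≡⟨ cong₂ (λ d t → S + ((S + (d + t)) + (S + d) + S)) ∑-evens T≡S ⟩
    S + ((S + (S + S)) + (S + S) + S)
      ≡⟨ seven S ⟩
    7 * S ∎
    where
    open ≡-Reasoning
    open OddModulus h g even
    S = ∑ h (g ∘ suc)
    D = ∑ h (λ i → g (suc (suc (i * 2))))
    T = ∑ h (λ i → g (suc i * 3))
    seven : ∀ s → s + ((s + (s + s)) + (s + s) + s) ≡ 7 * s
    seven = solve-∀
    thrice : ∀ i → suc i + suc i + suc i ≡ suc i * 3
    thrice = solve-∀
    differences : ∀ i → pairSum g (fourSet (suc i) (suc i)) ≡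
      (g (suc i) + (g (suc (suc (i * 2))) + g (suc i * 3)))
        + (g (suc i) + g (suc (suc (i * 2)))) + g (suc i)
    differences i = trans (pairSum-fourSet g (suc i) (suc i))
      (cong₂ (λ d t → (g (suc i) + (g d + g t)) + (g (suc i) + g d) + g (suc i)) (twice i) (thrice i))
    tripled : EvenPeriodic n (λ z → g (z * 3))
    tripled k {y} {z} y+z≡kn = even (k * 3)
      (trans (sym (*-distribʳ-+ 3 y z)) (trans (cong (_* 3) y+z≡kn) (commute k n)))
      where
      commute : ∀ k n → k * n * 3 ≡ k * 3 * n
      commute = solve-∀
    -- Tripling permutes all nonzero residues but need not preserve 1, ..., h. Both sums are
    -- therefore doubled to run over all residues, `z ↦ g (z * 3)` being even and periodic as well.
    T≡S : T ≡ S
    T≡S = +-double-injective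
      (trans (sym (OddModulus.∑-all-residues h (λ z → g (z * 3)) tripled))
        (trans (tripling even) ∑-all-residues))

-- Moduli divisible by 3.

module MultipleOf3 (k : ℕ) where

  -- Here n = 6K + 3 with K at least 1, so n = 3 is left out; `k` counts the multiples of 3 from 6
  -- to 3K.
  K h n : ℕ
  K = suc k
  h = suc (K * 3)
  n = suc (h * 2)

  -- The classes missing from fourSets, where the index j stands for i = j + 2.
  es : List ℕ
  es = h ∷ applyDownFrom (λ i → suc i * 3) K ++
           applyDownFrom (λ i → suc (suc i) * 3) k ++
           applyDownFrom (λ i → 1 + i * 3) (suc K)

  -- The set {0, i, 2i, 3i} degenerates at i = n / 3, where 3i is 0 modulo `n`; hence the last gap
  -- is i - 1. For i = 1 that gap would be 0 and repeat a point, so {0, 1, 2, 3} is taken instead.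
  fourSets : List (List ℕ)
  fourSets = fourSet 1 1 ∷ applyDownFrom (λ j → fourSet (suc (suc j)) (suc j)) (K * 3)

  module _ (g : ℕ → ℕ) (even : EvenPeriodic n g) where

    open ≡-Reasoning
    open OddModulus h g even

    S T W Z S₃ S₃′ : ℕ
    S   = ∑ h (g ∘ suc)
    T   = ∑ K (λ i → g (2 + i * 3))
    W   = ∑ (suc K) (λ i → g (1 + i * 3))
    Z   = ∑ h (λ i → g (2 + i * 3))
    S₃  = ∑ K (λ i → g (suc i * 3))
    S₃′ = ∑ k (λ i → g (suc (suc i) * 3))

    -- The numbers 1, ..., 2h are sorted modulo 3. As 3 divides `n`, negation fixes class 0 and
    -- swaps 1 and 2, while reduction modulo `n` preserves all three. So the differences 3i - 1 in
    -- `Z` fall short of two full covers by `S₃ + S₃ + W`, which the 2-sets and the difference 3 of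
    -- {0, 1, 2, 3} supply.
    residues-by-class : S + S ≡ Z + (S₃ + S₃) + W
    residues-by-class = begin
      S + S
        ≡⟨ ∑-all-residues ⟨
      g (2 + K * 3 * 2) + (g (1 + K * 3 * 2) + ∑ (K * 3 * 2) (g ∘ suc))
        ≡⟨ cong (λ N → g (2 + N) + (g (1 + N) + ∑ N (g ∘ suc))) (double K) ⟩
      a + (b + ∑ ((K + K) * 3) (g ∘ suc))
        ≡⟨ cong (λ s → a + (b + s)) (∑-triples (K + K) (g ∘ suc)) ⟩
      a + (b + (P₁ + P₂ + P₃))
        ≡⟨ rearrange a b P₁ P₂ P₃ ⟩
      (b + P₁) + (a + P₂) + P₃
        ≡⟨ cong₂ (λ s t → s + (a + P₂) + t) ones P₃≡ ⟩
      (T + W) + (a + P₂) + (S₃ + S₃)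
        ≡⟨ rearrange′ T W (a + P₂) (S₃ + S₃) ⟩
      (T + (a + P₂)) + (S₃ + S₃) + W
        ≡⟨ cong (λ z → z + (S₃ + S₃) + W) Z≡ ⟨
      Z + (S₃ + S₃) + W ∎
      where
      a = g (2 + (K + K) * 3)
      b = g (1 + (K + K) * 3)
      P₁ = ∑ (K + K) (λ i → g (1 + i * 3))
      P₂ = ∑ (K + K) (λ i → g (2 + i * 3))
      P₃ = ∑ (K + K) (λ i → g (3 + i * 3))
      double : ∀ K → K * 3 * 2 ≡ (K + K) * 3
      double = solve-∀
      rearrange : ∀ a b p q r → a + (b + (p + q + r)) ≡ (b + p) + (a + q) + r
      rearrange = solve-∀
      rearrange′ : ∀ t w u s → (t + w) + u + s ≡ (t + u) + s + w
      rearrange′ = solve-∀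
      -- Of 1, 4, ..., 6K + 1 the lowest K + 1 form `W`; the upper K are the negatives of 2, 5, ...,
      -- 3K - 1.
      ones : b + P₁ ≡ T + W
      ones = begin
        ∑ (suc (K + K)) f                                ≡⟨ cong (λ N → ∑ N f) (+-suc K K) ⟨
        ∑ (K + suc K) f                                  ≡⟨ ∑-split K (suc K) f ⟩
        ∑ K (λ i → f (i + suc K)) + W                    ≡⟨ cong (_+ W) (∑-reflect K λ i j eq → even 1 (mirror i j K eq)) ⟩
        T + W ∎
        where
        f = λ i → g (1 + i * 3)
        mirror : ∀ i j K → suc (i + j) ≡ K →
          1 + (i + suc K) * 3 + (2 + j * 3) ≡ 1 * suc (suc (K * 3) * 2)
        mirror i j _ refl = ring i j
          where
          ring : ∀ i j → 1 + (i + suc (suc (i + j))) * 3 + (2 + j * 3) ≡ 1 * suc (suc (suc (i + j) * 3) * 2)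
          ring = solve-∀
      P₃≡ : P₃ ≡ S₃ + S₃
      P₃≡ = trans (∑-split K K (λ i → g (3 + i * 3)))
        (cong (_+ S₃) (∑-reflect K λ i j eq → even 1 (mirror i j K eq)))
        where
        mirror : ∀ i j K → suc (i + j) ≡ K →
          3 + (i + K) * 3 + suc j * 3 ≡ 1 * suc (suc (K * 3) * 2)
        mirror i j _ refl = ring i j
          where
          ring : ∀ i j → 3 + (i + suc (i + j)) * 3 + suc j * 3 ≡ 1 * suc (suc (suc (i + j) * 3) * 2)
          ring = solve-∀
      -- The first 2K + 1 terms exhaust the residues that are 2 modulo 3; the remaining K pass `n`
      -- once and restart at 2.
      Z≡ : Z ≡ T + (a + P₂)
      Z≡ = begin
        ∑ (suc (K * 3)) f                                ≡⟨ cong (λ N → ∑ N f) (thirds K) ⟩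
        ∑ (K + suc (K + K)) f                            ≡⟨ ∑-split K (suc (K + K)) f ⟩
        ∑ K (λ i → f (i + suc (K + K))) + (a + P₂)       ≡⟨ cong (_+ (a + P₂)) (∑-ext K λ i →
                                                              trans (cong g (wrap i K)) (periodic (h * 2) even 1 (2 + i * 3))) ⟩
        T + (a + P₂) ∎
        where
        f = λ i → g (2 + i * 3)
        thirds : ∀ K → suc (K * 3) ≡ K + suc (K + K)
        thirds = solve-∀
        wrap : ∀ i K → 2 + (i + suc (K + K)) * 3 ≡ 1 * suc (suc (K * 3) * 2) + (2 + i * 3)
        wrap = solve-∀

    sum-es : sum (map g es) ≡ g h + (S₃ + (S₃′ + W))
    sum-es = cong (g h +_) (begin
      sum (map g (xs ++ ys ++ zs))                      ≡⟨ sum-map-++ xs (ys ++ zs) ⟩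
      sum (map g xs) + sum (map g (ys ++ zs))           ≡⟨ cong (sum (map g xs) +_) (sum-map-++ ys zs) ⟩
      sum (map g xs) + (sum (map g ys) + sum (map g zs))
        ≡⟨ cong₂ _+_ (sum-map-applyDownFrom g _ K)
             (cong₂ _+_ (sum-map-applyDownFrom g _ k) (sum-map-applyDownFrom g _ (suc K))) ⟩
      S₃ + (S₃′ + W) ∎)
      where
      xs = applyDownFrom (λ i → suc i * 3) K
      ys = applyDownFrom (λ i → suc (suc i) * 3) k
      zs = applyDownFrom (λ i → 1 + i * 3) (suc K)
      sum-map-++ : ∀ xs ys → sum (map g (xs ++ ys)) ≡ sum (map g xs) + sum (map g ys)
      sum-map-++ xs ys = trans (cong sum (map-++ g xs ys)) (sum-++ (map g xs) (map g ys))

    -- For i = j + 2 running from 2 to h, the arguments are i, 2i, 3i - 1, 2i - 1 and i - 1: the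
    -- differences of {0, i, 2i, 3i - 1}, among which i occurs twice.
    A B C D V : ℕ
    A = ∑ (K * 3) (λ j → g (suc (suc j)))
    B = ∑ (K * 3) (λ j → g (suc (suc (suc j * 2))))
    C = ∑ (K * 3) (λ j → g (2 + suc j * 3))
    D = ∑ (K * 3) (λ j → g (suc (suc j * 2)))
    V = ∑ (K * 3) (λ j → g (suc j))

    sum-fourSets : sum (map (pairSum g) fourSets) ≡
      ((g 1 + (g 2 + g 3)) + (g 1 + g 2) + g 1) + ((A + (B + C)) + (A + D) + V)
    sum-fourSets = cong₂ _+_ (pairSum-fourSet g 1 1)
      (trans (sum-map-applyDownFrom (pairSum g) (λ j → fourSet (suc (suc j)) (suc j)) (K * 3))
        (trans (∑-ext (K * 3) differences)
          (∑-fourSet-shape (K * 3) (λ j → g (suc (suc j))) (λ j → g (suc (suc (suc j * 2)))) (λ j → g (2 + suc j * 3))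
             (λ j → g (suc (suc j))) (λ j → g (suc (suc j * 2))) (λ j → g (suc j)))))
      where
      u+u : ∀ j → suc (suc j) + suc (suc j) ≡ suc (suc (suc j * 2))
      u+u = solve-∀
      u+w : ∀ j → suc (suc j) + suc j ≡ suc (suc j * 2)
      u+w = solve-∀
      u+u+w : ∀ j → suc (suc j) + suc (suc j) + suc j ≡ 2 + suc j * 3
      u+u+w = solve-∀
      differences : ∀ j → pairSum g (fourSet (suc (suc j)) (suc j)) ≡
        (g (suc (suc j)) + (g (suc (suc (suc j * 2))) + g (2 + suc j * 3)))
          + (g (suc (suc j)) + g (suc (suc j * 2))) + g (suc j)
      differences j = trans (pairSum-fourSet g (suc (suc j)) (suc j))
        (cong₂ _+_ (cong₂ (λ s t → (g (suc (suc j)) + s) + (g (suc (suc j)) + t))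
          (cong₂ (λ s t → g s + g t) (u+u j) (u+u+w j)) (cong g (u+w j))) refl)

    balance : sum (map (pairSum g) (map twoSet es)) + sum (map (pairSum g) fourSets) ≡ 7 * S
    balance = begin
      sum (map (pairSum g) (map twoSet es)) + sum (map (pairSum g) fourSets)
        ≡⟨ cong₂ _+_ (trans (sum-map-twoSets g es) sum-es) sum-fourSets ⟩
      (g h + (S₃ + (S₃′ + W))) +
      (((g 1 + (g 2 + g 3)) + (g 1 + g 2) + g 1) + ((A + (B + C)) + (A + D) + V))
        -- The differences 1, 1, 1, 2, 2 of {0, 1, 2, 3} are the missing terms for i = 1 of `A`
        -- (twice), `D`, `B` and `C`, and its difference 3 completes `S₃′`. The 2-set {0, h}
        -- completes `V`, which stops at h - 1.
        ≡⟨ regroup (g h) S₃ S₃′ W (g 1) (g 2) (g 3) A B C D V ⟩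
      (g 1 + A) + (g 1 + A) + (g 2 + B) + (g 1 + D) + (g h + V) + ((g 2 + C) + (S₃ + (g 3 + S₃′)) + W)
        ≡⟨ cong₂ (λ s t → s + (g h + V) + t)
             (cong₂ _+_ (cong₂ _+_ (cong₂ _+_ firstA firstA) firstB) firstD)
             (cong₂ (λ z t → z + (S₃ + t) + W) firstC firstS₃) ⟩
      S + S + S + S + S + (Z + (S₃ + S₃) + W)
        ≡⟨ cong (S + S + S + S + S +_) residues-by-class ⟨
      S + S + S + S + S + (S + S)
        ≡⟨ seven S ⟩
      7 * S ∎
      where
      seven : ∀ s → s + s + s + s + s + (s + s) ≡ 7 * s
      seven = solve-∀
      regroup : ∀ gh s s′ w g₁ g₂ g₃ a b c d v →
        (gh + (s + (s′ + w))) + (((g₁ + (g₂ + g₃)) + (g₁ + g₂) + g₁) + ((a + (b + c)) + (a + d) + v)) ≡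
        (g₁ + a) + (g₁ + a) + (g₂ + b) + (g₁ + d) + (gh + v) + ((g₂ + c) + (s + (g₃ + s′)) + w)
      regroup = solve-∀
      firstA : g 1 + A ≡ S
      firstA = sym (∑-first (K * 3) (g ∘ suc))
      firstB : g 2 + B ≡ S
      firstB = trans (sym (∑-first (K * 3) (λ i → g (suc (suc (i * 2)))))) ∑-evens
      firstC : g 2 + C ≡ Z
      firstC = sym (∑-first (K * 3) (λ i → g (2 + i * 3)))
      firstD : g 1 + D ≡ S
      firstD = trans (sym (∑-first (K * 3) (λ i → g (suc (i * 2))))) ∑-odds
      firstS₃ : g 3 + S₃′ ≡ S₃
      firstS₃ = sym (∑-first k (λ i → g (suc i * 3)))

  length-es : length es ≡ h
  length-es = cong suc (trans (length-++ (applyDownFrom (λ i → suc i * 3) K))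
    (trans (cong₂ _+_ (length-applyDownFrom _ K)
      (trans (length-++ (applyDownFrom (λ i → suc (suc i) * 3) k))
        (cong₂ _+_ (length-applyDownFrom _ k) (length-applyDownFrom _ (suc K)))))
      (total k)))
    where
    total : ∀ k → suc k + (k + suc (suc k)) ≡ suc k * 3
    total = solve-∀

  h<n : h < n
  h<n = s≤s (m≤m*n h 2)

  ∤-upto-h : ∀ {e} → e < h → n ∤ suc e
  ∤-upto-h e<h = >⇒∤ (≤-<-trans e<h h<n)

  valid-es : All (n ∤_) es
  valid-es = ∤-upto-h {K * 3} ≤-refl ∷
    ++⁺ (applyDownFrom⁺₁ _ K λ i<K → ∤-upto-h (m≤n⇒m≤1+n (*-monoˡ-≤ 3 i<K)))
    (++⁺ (applyDownFrom⁺₁ _ k λ i<k → ∤-upto-h (m≤n⇒m≤1+n (*-monoˡ-≤ 3 (s≤s i<k))))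
      (applyDownFrom⁺₁ _ (suc K) λ i≤K → ∤-upto-h (s≤s (*-monoˡ-≤ 3 (s≤s⁻¹ i≤K)))))

  valid-fourSets : All (λ Q → length Q ≡ 4 × Distinct n Q) fourSets
  valid-fourSets =
    (refl , Distinct-fourSet 1 1 (small z<s) (small z<s) (small (s<s z<s)) (small (s<s z<s)) (small (s<s (s<s z<s)))) ∷
    applyDownFrom⁺₁ _ (K * 3) λ {j} j<3K → refl ,
      Distinct-fourSet (suc (suc j)) (suc j) (∤-u j<3K) (∤-w j<3K) (∤-u+u j<3K) (∤-u+w j<3K) (∤-u+u+w j<3K)
    where
    small : ∀ {e} → e < 3 → n ∤ suc e
    small e<3 = ∤-upto-h (<-≤-trans e<3 (s≤s (s≤s (s≤s z≤n))))

    u+u : ∀ j → suc (suc j) + suc (suc j) ≡ suc (suc j) * 2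
    u+u = solve-∀

    u+u<n : ∀ {j} → j < K * 3 → suc (suc j) + suc (suc j) < n
    u+u<n {j} j<3K = s≤s (subst (_≤ h * 2) (sym (u+u j)) (*-monoˡ-≤ 2 (s≤s j<3K)))

    w<u : ∀ j → suc j ≤ suc (suc j)
    w<u j = n≤1+n (suc j)

    u<n : ∀ {j} → j < K * 3 → suc (suc j) < n
    u<n {j} j<3K = ≤-<-trans (m≤m+n (suc (suc j)) _) (u+u<n j<3K)

    ∤-u : ∀ {j} → j < K * 3 → n ∤ suc (suc j)
    ∤-u j<3K = >⇒∤ (u<n j<3K)

    ∤-w : ∀ {j} → j < K * 3 → n ∤ suc j
    ∤-w {j} j<3K = >⇒∤ (≤-<-trans (w<u j) (u<n j<3K))

    ∤-u+u : ∀ {j} → j < K * 3 → n ∤ suc (suc j) + suc (suc j)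
    ∤-u+u j<3K = >⇒∤ (u+u<n j<3K)

    ∤-u+w : ∀ {j} → j < K * 3 → n ∤ suc (suc j) + suc j
    ∤-u+w {j} j<3K = >⇒∤ (≤-<-trans (+-monoʳ-≤ (suc (suc j)) (w<u j)) (u+u<n j<3K))

    ∤-u+u+w : ∀ {j} → j < K * 3 → n ∤ suc (suc j) + suc (suc j) + suc j
    -- This difference, 3i - 1, is 2 modulo 3, whereas `n` is 0 modulo 3.
    ∤-u+u+w {j} j<3K = ∤-mod-3 z<s
      (+-mono-< (u+u<n j<3K) (≤-<-trans (w<u j) (u<n j<3K)))
      λ eq → contradiction (trans (sym n%3≡0) (trans eq z%3≡2)) λ ()
      where
      modulus : ∀ K → suc (suc (K * 3) * 2) ≡ suc (K * 2) * 3
      modulus = solve-∀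
      u+u+w : ∀ j → suc (suc j) + suc (suc j) + suc j ≡ 2 + suc j * 3
      u+u+w = solve-∀
      n%3≡0 : n % 3 ≡ 0
      n%3≡0 = trans (cong (_% 3) (modulus K)) (m*n%n≡0 (suc (K * 2)) 3)
      z%3≡2 : (suc (suc j) + suc (suc j) + suc j) % 3 ≡ 2
      z%3≡2 = trans (cong (_% 3) (u+u+w j)) ([m+kn]%n≡m%n 2 (suc j) 3)

  family : DifferenceFamily h
  family = record
    { Es        = map twoSet es
    ; Qs        = fourSets
    ; length-Es = trans (length-map twoSet es) length-es
    ; length-Qs = cong suc (length-applyDownFrom _ (K * 3))
    ; valid-Es  = map⁺ (All.map (λ n∤e → refl , Distinct-twoSet n∤e) valid-es)
    ; valid-Qs  = valid-fourSets
    ; balanced  = balance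
    }

-- Block counts as sums of indicators.

does-∈? : ∀ {v} (x : Fin v) B → does (x ∈? B) ≡ lookup B x
does-∈? zero    (true  ∷ B) = refl
does-∈? zero    (false ∷ B) = refl
does-∈? (suc x) (_     ∷ B) = does-∈? x B

length-filter : ∀ {A : Set} {P : A → Set} (P? : Decidable P) xs →
  length (filter P? xs) ≡ sum (map (λ x → bit (does (P? x))) xs)
length-filter P? []       = refl
length-filter P? (x ∷ xs) with does (P? x)
... | true  = cong suc (length-filter P? xs)
... | false = length-filter P? xs

#∋-sum : ∀ {v} (𝓑 : List (Subset v)) x → #∋ 𝓑 x ≡ sum (map (λ B → bit (lookup B x)) 𝓑)
#∋-sum 𝓑 x = trans (length-filter (λ B → x ∈? B) 𝓑)
  (cong sum (map-cong (λ B → cong bit (does-∈? x B)) 𝓑))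

#∋₂-sum : ∀ {v} (𝓑 : List (Subset v)) x y →
  #∋₂ 𝓑 x y ≡ sum (map (λ B → bit (lookup B x) * bit (lookup B y)) 𝓑)
#∋₂-sum 𝓑 x y = trans (length-filter (λ B → (x ∈? B) ×-dec (y ∈? B)) 𝓑)
  (cong sum (map-cong (λ B → trans (cong₂ (λ b c → bit (b ∧ c)) (does-∈? x B) (does-∈? y B))
                               (bit-∧ (lookup B x) (lookup B y))) 𝓑))

sum-map-concat : ∀ {A : Set} (w : A → ℕ) F n →
  sum (map w (concat (applyDownFrom F n))) ≡ ∑ n (λ a → sum (map w (F a)))
sum-map-concat w F zero    = refl
sum-map-concat w F (suc n) = trans (cong sum (map-++ w (F n) (concat (applyDownFrom F n))))
  (trans (sum-++ (map w (F n)) _) (cong (sum (map w (F n)) +_) (sum-map-concat w F n)))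

sum-map-concatMap : ∀ {A B : Set} (w : B → ℕ) (F : A → List B) xs →
  sum (map w (concatMap F xs)) ≡ sum (map (λ x → sum (map w (F x))) xs)
sum-map-concatMap w F []       = refl
sum-map-concatMap w F (x ∷ xs) = trans (cong sum (map-++ w (F x) (concatMap F xs)))
  (trans (sum-++ (map w (F x)) _) (cong (sum (map w (F x)) +_) (sum-map-concatMap w F xs)))

sum-map-All-const : ∀ {A : Set} {f : A → ℕ} {c xs} → All (λ x → f x ≡ c) xs →
  sum (map f xs) ≡ length xs * c
sum-map-All-const []         = refl
sum-map-All-const (fx≡c ∷ p) = cong₂ _+_ fx≡c (sum-map-All-const p)

sum-map-All : ∀ {A : Set} {f g : A → ℕ} {xs} → All (λ x → f x ≡ g x) xs →
  sum (map f xs) ≡ sum (map g xs)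
sum-map-All []            = refl
sum-map-All (fx≡gx ∷ p) = cong₂ _+_ fx≡gx (sum-map-All p)

sum-map-*ˡ : ∀ {A : Set} c (f : A → ℕ) xs → sum (map (λ x → c * f x) xs) ≡ c * sum (map f xs)
sum-map-*ˡ c f []       = sym (*-zeroʳ c)
sum-map-*ˡ c f (x ∷ xs) =
  trans (cong (c * f x +_) (sum-map-*ˡ c f xs)) (sym (*-distribˡ-+ c (f x) (sum (map f xs))))

sum-map-zip : ∀ {A B : Set} (f : A → ℕ) (g : B → ℕ) xs ys → length xs ≡ length ys →
  sum (map (λ (x , y) → f x + g y) (zip xs ys)) ≡ sum (map f xs) + sum (map g ys)
sum-map-zip f g []       []       _  = refl
sum-map-zip f g (x ∷ xs) (y ∷ ys) eq =
  trans (cong (f x + g y +_) (sum-map-zip f g xs ys (suc-injective eq)))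
    (interchange +-commutativeSemigroup (f x) (g y) (sum (map f xs)) (sum (map g ys)))

All-zip : ∀ {A B : Set} {P : A → Set} {Q : B → Set} {xs ys} → All P xs → All Q ys →
  All (λ (x , y) → P x × Q y) (zip xs ys)
All-zip []       _        = []
All-zip (_ ∷ _)  []       = []
All-zip (p ∷ ps) (q ∷ qs) = (p , q) ∷ All-zip ps qs

-- A term that depends on one translation is repeated `n` times by the other. This is the source of
-- the factor `n` in the counts inside a group.
∑∑-+ : ∀ n s t → ∑ n (λ a → ∑ n (λ b → s a + t b)) ≡ n * (∑ n s + ∑ n t)
∑∑-+ n s t = begin
  ∑ n (λ a → ∑ n (λ b → s a + t b))
    ≡⟨ ∑-ext n (λ a → trans (∑-+ n (λ _ → s a) t) (cong (_+ ∑ n t) (∑-const n (s a)))) ⟩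
  ∑ n (λ a → n * s a + ∑ n t)
    ≡⟨ ∑-+ n (λ a → n * s a) (λ _ → ∑ n t) ⟩
  ∑ n (λ a → n * s a) + ∑ n (λ _ → ∑ n t)
    ≡⟨ cong₂ _+_ (∑-*ˡ n n s) (∑-const n (∑ n t)) ⟩
  n * ∑ n s + n * ∑ n t
    ≡⟨ *-distribˡ-+ n (∑ n s) (∑ n t) ⟨
  n * (∑ n s + ∑ n t) ∎
  where open ≡-Reasoning

-- Independence of the two translations: counts for mixed pairs multiply.
∑∑-* : ∀ n s t → ∑ n (λ a → ∑ n (λ b → s a * t b)) ≡ ∑ n s * ∑ n t
∑∑-* n s t = trans (∑-ext n (λ a → ∑-*ˡ n (s a) t)) (∑-*ʳ n (∑ n t) s)

size-tabulate : ∀ k (f : ℕ → Bool) → ∣ tabulate {n = k} (f ∘ toℕ) ∣ ≡ ∑ k (bit ∘ f)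
size-tabulate zero    f = refl
size-tabulate (suc k) f = trans (head (f 0)) (sym (∑-first k (bit ∘ f)))
  where
  head : ∀ b → ∣ b ∷ tabulate {n = k} (f ∘ suc ∘ toℕ) ∣ ≡ bit b + ∑ k (bit ∘ f ∘ suc)
  head true  = cong suc (size-tabulate k (f ∘ suc))
  head false = size-tabulate k (f ∘ suc)

size-tabulate-+ : ∀ m {k} (f : Fin (m + k) → Bool) →
  ∣ tabulate f ∣ ≡ ∣ tabulate (λ i → f (i ↑ˡ k)) ∣ + ∣ tabulate (λ j → f (m ↑ʳ j)) ∣
size-tabulate-+ zero    f = refl
size-tabulate-+ (suc m) f with f zero
... | true  = cong suc (size-tabulate-+ m (f ∘ suc))
... | false = size-tabulate-+ m (f ∘ suc)

∩-tabulate : ∀ {k} (f g : Fin k → Bool) → tabulate f ∩ tabulate g ≡ tabulate (λ x → f x ∧ g x)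
∩-tabulate {zero}  f g = refl
∩-tabulate {suc k} f g = cong ((f zero ∧ g zero) ∷_) (∩-tabulate (f ∘ suc) (g ∘ suc))

-- The point set as two copies of 0, ..., n - 1.

module TwoGroups (n : ℕ) where

  side : Fin (2 * n) → Fin 2
  side p = proj₁ (remQuot n p)

  position : Fin (2 * n) → ℕ
  position p = toℕ (proj₂ (remQuot {2} n p))

  -- Describing a block by group and position turns its size and its intersection with a group into
  -- sums over positions.
  subset : (Fin 2 → ℕ → Bool) → Subset (2 * n)
  subset f = tabulate (λ p → f (side p) (position p))

  lookup-subset : ∀ f p → lookup (subset f) p ≡ f (side p) (position p)
  lookup-subset f = lookup∘tabulate (λ p → f (side p) (position p))

  position<n : ∀ p → position p < n
  position<n p = toℕ<n (proj₂ (remQuot {2} n p))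

  position-injective : ∀ p q → side p ≡ side q → position p ≡ position q → p ≡ q
  position-injective p q sp≡sq pp≡pq = begin
    p                                 ≡⟨ combine-remQuot {2} n p ⟨
    uncurry combine (remQuot {2} n p) ≡⟨ cong₂ combine sp≡sq (toℕ-injective pp≡pq) ⟩
    uncurry combine (remQuot {2} n q) ≡⟨ combine-remQuot {2} n q ⟩
    q                                 ∎
    where open ≡-Reasoning

  size-subset : ∀ f → ∣ subset f ∣ ≡ ∑ n (bit ∘ f zero) + ∑ n (bit ∘ f (suc zero))
  size-subset f = begin
    ∣ subset f ∣
      ≡⟨ size-tabulate-+ n {1 * n} F ⟩
    ∣ tabulate (half zero) ∣ + ∣ tabulate {n = 1 * n} (λ y → F (n ↑ʳ y)) ∣
      -- `2 * n` unfolds to `n + (n + 0)`, so the second split leaves an empty tail of size 0.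
      ≡⟨ cong (∣ tabulate (half zero) ∣ +_) (size-tabulate-+ n {0 * n} (λ y → F (n ↑ʳ y))) ⟩
    ∣ tabulate (half zero) ∣ + (∣ tabulate (half (suc zero)) ∣ + 0)
      ≡⟨ cong₂ _+_ (size-half zero) (trans (+-identityʳ ∣ tabulate (half (suc zero)) ∣) (size-half (suc zero))) ⟩
    ∑ n (bit ∘ f zero) + ∑ n (bit ∘ f (suc zero)) ∎
    where
    open ≡-Reasoning
    F : Fin (2 * n) → Bool
    F p = f (side p) (position p)
    half : Fin 2 → Fin n → Bool
    half i x = F (combine i x)
    size-half : ∀ i → ∣ tabulate (half i) ∣ ≡ ∑ n (bit ∘ f i)
    size-half i = trans
      (cong ∣_∣ (tabulate-cong {f = half i} {g = f i ∘ toℕ}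
        (λ x → cong (λ (j , y) → f j (toℕ y)) (remQuot-combine {2} {n} i x))))
      (size-tabulate n (f i))

  size-subset∩ : ∀ f i → ∣ subset f ∩ fibre side i ∣ ≡ ∑ n (bit ∘ f i)
  size-subset∩ f i = trans
    (cong ∣_∣ (∩-tabulate (λ p → f (side p) (position p)) (λ p → does (side p ≟ᶠ i))))
    (trans (size-subset (λ j x → f j x ∧ does (j ≟ᶠ i))) (select i))
    where
    inside : ∀ j → ∑ n (λ x → bit (f j x ∧ true)) ≡ ∑ n (bit ∘ f j)
    inside j = ∑-ext n (λ x → trans (bit-∧ (f j x) true) (*-identityʳ (bit (f j x))))
    outside : ∀ j → ∑ n (λ x → bit (f j x ∧ false)) ≡ 0
    outside j = trans (∑-ext n (λ x → trans (bit-∧ (f j x) false) (*-zeroʳ (bit (f j x)))))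
      (∑-zero n)
    select : ∀ i → ∑ n (λ x → bit (f zero x ∧ does (zero ≟ᶠ i))) +
                   ∑ n (λ x → bit (f (suc zero) x ∧ does (suc zero ≟ᶠ i))) ≡ ∑ n (bit ∘ f i)
    select zero       = trans (cong₂ _+_ (inside zero) (outside (suc zero))) (+-identityʳ (∑ n (bit ∘ f zero)))
    select (suc zero) = cong₂ _+_ (outside zero) (inside (suc zero))

  size-side : ∀ i → ∣ fibre side i ∣ ≡ n
  size-side i = trans (size-subset (λ j _ → does (j ≟ᶠ i)))
    (trans (cong₂ _+_ (∑-const n _) (∑-const n _)) (total i))
    where
    total : ∀ i → n * bit (does (zero ≟ᶠ i)) + n * bit (does (suc zero ≟ᶠ i)) ≡ n
    total zero       = trans (cong₂ _+_ (*-identityʳ n) (*-zeroʳ n)) (+-identityʳ n)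
    total (suc zero) = cong₂ _+_ (*-zeroʳ n) (*-identityʳ n)

-- The blocks of the design and their counts.

module Construction (h : ℕ) (F : DifferenceFamily h) where

  open ≡-Reasoning
  open DifferenceFamily F using (Es; Qs; length-Es; length-Qs; valid-Es; valid-Qs; balanced)
  open Translates (h * 2)
  open TwoGroups n

  Valid : List ℕ × List ℕ → Set
  Valid (E , Q) = (length E ≡ 2 × Distinct n E) × (length Q ≡ 4 × Distinct n Q)

  -- `t` is the group that receives the 2-set.
  contents : List ℕ × List ℕ → ℕ → ℕ → Fin 2 → Fin 2 → ℕ → Bool
  contents (E , Q) a b t i = if does (i ≟ᶠ t) then translate E a else translate Q b

  orientations : List ℕ × List ℕ → ℕ → ℕ → List (Subset (2 * n))
  orientations EQ a b = subset (contents EQ a b zero) ∷ subset (contents EQ a b (suc zero)) ∷ []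

  row : List ℕ × List ℕ → ℕ → List (Subset (2 * n))
  row EQ a = concat (applyDownFrom (orientations EQ a) n)

  orbit : List ℕ × List ℕ → List (Subset (2 * n))
  orbit EQ = concat (applyDownFrom (row EQ) n)

  bases : List (List ℕ × List ℕ)
  bases = zip Es Qs

  blocks : List (Subset (2 * n))
  blocks = concatMap orbit bases

  valid-bases : All Valid bases
  valid-bases = All-zip valid-Es valid-Qs

  length-bases : length bases ≡ h
  length-bases = trans (length-zipWith _,_ Es Qs)
    (trans (cong₂ _⊓_ length-Es length-Qs) (⊓-idem h))

  All-orbit : ∀ {P : Subset (2 * n) → Set} EQ →
    (∀ a b t → P (subset (contents EQ a b t))) → All P (orbit EQ)
  All-orbit EQ p = concat⁺ (applyDownFrom⁺₂ (row EQ) n λ a → concat⁺ (applyDownFrom⁺₂ (orientations EQ a) n λ b →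
    p a b zero ∷ p a b (suc zero) ∷ []))

  All-blocks : ∀ {P : Subset (2 * n) → Set} →
    (∀ {EQ} → Valid EQ → ∀ a b t → P (subset (contents EQ a b t))) → All P blocks
  All-blocks {P} p = concat⁺ (map⁺ (All.map (λ {EQ} v → All-orbit EQ (p v)) valid-bases))

  sum-orbit : ∀ EQ (w : Subset (2 * n) → ℕ) → sum (map w (orbit EQ)) ≡
    ∑ n (λ a → ∑ n (λ b → w (subset (contents EQ a b zero)) + w (subset (contents EQ a b (suc zero)))))
  sum-orbit EQ w = trans (sum-map-concat w (row EQ) n) (∑-ext n λ a →
    trans (sum-map-concat w (orientations EQ a) n) (∑-ext n λ b →
      cong (w (subset (contents EQ a b zero)) +_) (+-identityʳ (w (subset (contents EQ a b (suc zero)))))))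

  ∑-translate : ∀ {L} → Distinct n L → ∀ {x} → x < n → ∑ n (λ a → bit (translate L a x)) ≡ length L
  ∑-translate {L} dL {x} x<n = trans (∑-ext n (λ a → bit-translate dL a x)) (∑-hits L x<n)

  size-translate : ∀ {L} → Distinct n L → ∀ a → ∑ n (λ x → bit (translate L a x)) ≡ length L
  size-translate {L} dL a = trans (∑-ext n (bit-translate dL a)) (∑-hits-points L a)

  opposite : Fin 2 → Fin 2
  opposite zero       = suc zero
  opposite (suc zero) = zero

  opposite-≢ : ∀ t → t ≢ opposite t
  opposite-≢ zero       ()
  opposite-≢ (suc zero) ()

  small-part : ∀ {EQ} → Valid EQ → ∀ a b t → ∑ n (bit ∘ contents EQ a b t t) ≡ 2
  small-part ((∣E∣ , dE) , _) a b zero       = trans (size-translate dE a) ∣E∣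
  small-part ((∣E∣ , dE) , _) a b (suc zero) = trans (size-translate dE a) ∣E∣

  large-part : ∀ {EQ} → Valid EQ → ∀ a b t → ∑ n (bit ∘ contents EQ a b t (opposite t)) ≡ 4
  large-part (_ , ∣Q∣ , dQ) a b zero       = trans (size-translate dQ b) ∣Q∣
  large-part (_ , ∣Q∣ , dQ) a b (suc zero) = trans (size-translate dQ b) ∣Q∣

  size-block : ∀ {EQ} → Valid EQ → ∀ a b t → ∣ subset (contents EQ a b t) ∣ ≡ 6
  size-block {EQ} v a b zero = trans (size-subset (contents EQ a b zero))
    (cong₂ _+_ (small-part v a b zero) (large-part v a b zero))
  size-block {EQ} v a b (suc zero) = trans (size-subset (contents EQ a b (suc zero)))
    (cong₂ _+_ (large-part v a b (suc zero)) (small-part v a b (suc zero)))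

  pair-bits : ∀ EQ p q a b t →
    bit (lookup (subset (contents EQ a b t)) p) * bit (lookup (subset (contents EQ a b t)) q) ≡
    bit (contents EQ a b t (side p) (position p)) * bit (contents EQ a b t (side q) (position q))
  pair-bits EQ p q a b t = cong₂ (λ c d → bit c * bit d)
    (lookup-subset (contents EQ a b t) p) (lookup-subset (contents EQ a b t) q)

  -- Over both orientations the group of `p` receives the 2-set once and the 4-set once, meeting `p`
  -- for 2 and 4 translations; the other translation is free.
  orbit-replication : ∀ {EQ} → Valid EQ → ∀ p →
    sum (map (λ B → bit (lookup B p)) (orbit EQ)) ≡ n * 6
  orbit-replication {EQ@(E , Q)} ((∣E∣ , dE) , (∣Q∣ , dQ)) p = begin
    sum (map (λ B → bit (lookup B p)) (orbit EQ))
      ≡⟨ sum-orbit EQ (λ B → bit (lookup B p)) ⟩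
    ∑ n (λ a → ∑ n (λ b → bit (lookup (subset (contents EQ a b zero)) p)
                        + bit (lookup (subset (contents EQ a b (suc zero))) p)))
      ≡⟨ ∑-ext n (λ a → ∑-ext n (λ b → trans
           (cong₂ (λ c d → bit c + bit d) (lookup-subset (contents EQ a b zero) p)
                                          (lookup-subset (contents EQ a b (suc zero)) p))
           (orient a b (side p)))) ⟩
    ∑ n (λ a → ∑ n (λ b → bit (translate E a x) + bit (translate Q b x)))
      ≡⟨ ∑∑-+ n (λ a → bit (translate E a x)) (λ b → bit (translate Q b x)) ⟩
    n * (∑ n (λ a → bit (translate E a x)) + ∑ n (λ b → bit (translate Q b x)))
      ≡⟨ cong (n *_) (cong₂ _+_ (trans (∑-translate dE x<n) ∣E∣) (trans (∑-translate dQ x<n) ∣Q∣)) ⟩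
    n * 6 ∎
    where
    x = position p
    x<n = position<n p
    orient : ∀ a b i → bit (contents EQ a b zero i x) + bit (contents EQ a b (suc zero) i x)
                     ≡ bit (translate E a x) + bit (translate Q b x)
    orient a b zero       = refl
    orient a b (suc zero) = +-comm (bit (translate Q b x)) _

  -- Each orientation places one of the points with the 2-set and the other with the 4-set, giving 2
  -- · 4 choices of translations.
  orbit-cross : ∀ {EQ} → Valid EQ → ∀ p q → side p ≢ side q →
    sum (map (λ B → bit (lookup B p) * bit (lookup B q)) (orbit EQ)) ≡ 16
  orbit-cross {EQ@(E , Q)} ((∣E∣ , dE) , (∣Q∣ , dQ)) p q sp≢sq = begin
    sum (map (λ B → bit (lookup B p) * bit (lookup B q)) (orbit EQ))
      ≡⟨ sum-orbit EQ (λ B → bit (lookup B p) * bit (lookup B q)) ⟩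
    ∑ n (λ a → ∑ n (λ b →
      bit (lookup (subset (contents EQ a b zero)) p) * bit (lookup (subset (contents EQ a b zero)) q) +
      bit (lookup (subset (contents EQ a b (suc zero))) p) * bit (lookup (subset (contents EQ a b (suc zero))) q)))
      ≡⟨ ∑-ext n (λ a → ∑-ext n (λ b → trans
           (cong₂ _+_ (pair-bits EQ p q a b zero) (pair-bits EQ p q a b (suc zero)))
           (orient a b (side p) (side q) sp≢sq))) ⟩
    ∑ n (λ a → ∑ n (λ b → e a x * f b y + e a y * f b x))
      ≡⟨ ∑-ext n (λ a → ∑-+ n (λ b → e a x * f b y) (λ b → e a y * f b x)) ⟩
    ∑ n (λ a → ∑ n (λ b → e a x * f b y) + ∑ n (λ b → e a y * f b x))
      ≡⟨ ∑-+ n (λ a → ∑ n (λ b → e a x * f b y)) (λ a → ∑ n (λ b → e a y * f b x)) ⟩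
    ∑ n (λ a → ∑ n (λ b → e a x * f b y)) + ∑ n (λ a → ∑ n (λ b → e a y * f b x))
      ≡⟨ cong₂ _+_ (∑∑-* n (λ a → e a x) (λ b → f b y)) (∑∑-* n (λ a → e a y) (λ b → f b x)) ⟩
    ∑ n (λ a → e a x) * ∑ n (λ b → f b y) + ∑ n (λ a → e a y) * ∑ n (λ b → f b x)
      ≡⟨ cong₂ _+_ (cong₂ _*_ (trans (∑-translate dE x<n) ∣E∣) (trans (∑-translate dQ y<n) ∣Q∣))
                   (cong₂ _*_ (trans (∑-translate dE y<n) ∣E∣) (trans (∑-translate dQ x<n) ∣Q∣)) ⟩
    16 ∎
    where
    x = position p
    y = position q
    x<n = position<n p
    y<n = position<n q
    e = λ a z → bit (translate E a z)
    f = λ b z → bit (translate Q b z)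
    orient : ∀ a b i j → i ≢ j →
      bit (contents EQ a b zero i x) * bit (contents EQ a b zero j y) +
      bit (contents EQ a b (suc zero) i x) * bit (contents EQ a b (suc zero) j y) ≡
      e a x * f b y + e a y * f b x
    orient a b zero       zero       i≢j = contradiction refl i≢j
    orient a b zero       (suc zero) i≢j = cong (e a x * f b y +_) (*-comm (f b x) (e a y))
    orient a b (suc zero) zero       i≢j =
      trans (+-comm (f b x * e a y) _) (cong (e a x * f b y +_) (*-comm (f b x) (e a y)))
    orient a b (suc zero) (suc zero) i≢j = contradiction refl i≢j

  module _ {p q : Fin (2 * n)} (p≢q : p ≢ q) (sp≡sq : side p ≡ side q) where

    private
      x = position p
      y = position q

    -- Distinct points of one group have distinct positions.
    open Pair {x} {y} (λ x≡y → p≢q (position-injective p q sp≡sq x≡y))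

    ∑-translate-pair : ∀ {L} → Distinct n L →
      ∑ n (λ a → bit (translate L a x) * bit (translate L a y)) ≡ pairSum coverage L
    ∑-translate-pair {L} dL = trans
      (∑-ext n (λ a → cong₂ _*_ (bit-translate dL a x) (bit-translate dL a y))) (∑-hits-pair L)

    -- In one orientation both points face the 2-set, in the other the 4-set, so only one
    -- translation is constrained at a time.
    orbit-same : ∀ {EQ@(E , Q) : List ℕ × List ℕ} → Valid EQ →
      sum (map (λ B → bit (lookup B p) * bit (lookup B q)) (orbit EQ)) ≡
      n * (pairSum coverage E + pairSum coverage Q)
    orbit-same {EQ@(E , Q)} ((_ , dE) , (_ , dQ)) = begin
      sum (map (λ B → bit (lookup B p) * bit (lookup B q)) (orbit EQ))
        ≡⟨ sum-orbit EQ (λ B → bit (lookup B p) * bit (lookup B q)) ⟩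
      ∑ n (λ a → ∑ n (λ b →
        bit (lookup (subset (contents EQ a b zero)) p) * bit (lookup (subset (contents EQ a b zero)) q) +
        bit (lookup (subset (contents EQ a b (suc zero))) p) * bit (lookup (subset (contents EQ a b (suc zero))) q)))
        ≡⟨ ∑-ext n (λ a → ∑-ext n (λ b → trans
             (cong₂ _+_ (pair-bits EQ p q a b zero) (pair-bits EQ p q a b (suc zero)))
             (orient a b (side p) (side q) sp≡sq))) ⟩
      ∑ n (λ a → ∑ n (λ b → e a x * e a y + f b x * f b y))
        ≡⟨ ∑∑-+ n (λ a → e a x * e a y) (λ b → f b x * f b y) ⟩
      n * (∑ n (λ a → e a x * e a y) + ∑ n (λ b → f b x * f b y))
        ≡⟨ cong (n *_) (cong₂ _+_ (∑-translate-pair dE) (∑-translate-pair dQ)) ⟩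
      n * (pairSum coverage E + pairSum coverage Q) ∎
      where
      e = λ a z → bit (translate E a z)
      f = λ b z → bit (translate Q b z)
      orient : ∀ a b i j → i ≡ j →
        bit (contents EQ a b zero i x) * bit (contents EQ a b zero j y) +
        bit (contents EQ a b (suc zero) i x) * bit (contents EQ a b (suc zero) j y) ≡
        e a x * e a y + f b x * f b y
      orient a b zero       _ refl = refl
      orient a b (suc zero) _ refl = +-comm (f b x * f b y) _

    -- The two differences x - y and y - x form a single class up to sign, so the total 2 over all
    -- nonzero residues is halved.
    covered-once : ∑ h (coverage ∘ suc) ≡ 1
    covered-once = +-double-injective (trans
      (sym (OddModulus.∑-all-residues h coverage coverage-even))
      (∑-coverage (position<n p) (position<n q)))

    pair-count : #∋₂ blocks p q ≡ 7 * n
    pair-count = begin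
      #∋₂ blocks p q
        ≡⟨ #∋₂-sum blocks p q ⟩
      sum (map (λ B → bit (lookup B p) * bit (lookup B q)) blocks)
        ≡⟨ sum-map-concatMap _ orbit bases ⟩
      sum (map (λ EQ → sum (map (λ B → bit (lookup B p) * bit (lookup B q)) (orbit EQ))) bases)
        ≡⟨ sum-map-All (All.map (λ {EQ} v → orbit-same {EQ} v) valid-bases) ⟩
      sum (map (λ (E , Q) → n * (pairSum coverage E + pairSum coverage Q)) bases)
        ≡⟨ sum-map-*ˡ n (λ (E , Q) → pairSum coverage E + pairSum coverage Q) bases ⟩
      n * sum (map (λ (E , Q) → pairSum coverage E + pairSum coverage Q) bases)
        ≡⟨ cong (n *_) (sum-map-zip (pairSum coverage) (pairSum coverage) Es Qs
             (trans length-Es (sym length-Qs))) ⟩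
      n * (sum (map (pairSum coverage) Es) + sum (map (pairSum coverage) Qs))
        -- The balance condition, tested on the coverage of this particular pair, gives its number
        -- of occurrences.
        ≡⟨ cong (n *_) (balanced coverage coverage-even) ⟩
      n * (7 * ∑ h (coverage ∘ suc))
        ≡⟨ cong (λ s → n * (7 * s)) covered-once ⟩
      n * 7
        ≡⟨ *-comm n 7 ⟩
      7 * n ∎

  design : GDD n 2 6 (7 * n) (8 * (n ∸ 1))
  design = record
    { groupOf         = side
    ; blocks          = blocks
    ; r               = h * (n * 6)
    ; group-size      = size-side
    ; block-size      = All-blocks size-block
    ; replication     = λ p → trans (#∋-sum blocks p)
        (trans (sum-map-concatMap _ orbit bases)
          (trans (sum-map-All-const (All.map (λ v → orbit-replication v p) valid-bases))
            (cong (_* (n * 6)) length-bases)))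
    ; same-group      = λ p q → pair-count
    ; different-group = λ p q sp≢sq → trans (#∋₂-sum blocks p q)
        (trans (sum-map-concatMap _ orbit bases)
          (trans (sum-map-All-const (All.map (λ v → orbit-cross v p q sp≢sq) valid-bases))
            (trans (cong (_* 16) length-bases) (sixteen h))))
    }
    where
    sixteen : ∀ h → h * 16 ≡ 8 * (h * 2)
    sixteen = solve-∀

  configuration : HasConfiguration 2 4 design
  configuration = All-blocks λ {EQ} v a b t → t , opposite t , opposite-≢ t ,
    trans (size-subset∩ (contents EQ a b t) t) (small-part v a b t) ,
    trans (size-subset∩ (contents EQ a b t) (opposite t)) (large-part v a b t)

-- Choice of the family and conclusion.

-- The remainders 0, 1, 2 of `h` modulo 3 make 2h + 1 congruent to 1, 0, 2, which selects the first
-- tripling lemma, the family for multiples of 3, or the second tripling lemma.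
differenceFamily : ∀ h → 4 ≤ suc (h * 2) → DifferenceFamily h
differenceFamily h 4≤n with h divMod 3
... | result k zero refl = coprimeFamily (k * 3) (tripling₁ (k * 2) (sixfold k))
  λ eq → contradiction (trans (sym (residue k)) eq) λ ()
  where
  sixfold : ∀ k → k * 3 * 2 ≡ k * 2 * 3
  sixfold = solve-∀
  residue : ∀ k → suc (k * 3 * 2) % 3 ≡ 1
  residue k = trans (cong (λ m → suc m % 3) (sixfold k)) ([m+kn]%n≡m%n 1 (k * 2) 3)
... | result (suc k) (suc zero) refl = MultipleOf3.family k
-- Here `h` is 1 and the modulus 3, below the bound 4.
... | result zero (suc zero) refl = contradiction 4≤n λ { (s≤s (s≤s (s≤s ()))) }
... | result k (suc (suc zero)) refl = coprimeFamily (2 + k * 3) (tripling₂ (suc (k * 2)) (sixfold k))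
  λ eq → contradiction (trans (sym (residue k)) eq) λ ()
  where
  sixfold : ∀ k → (2 + k * 3) * 2 ≡ suc (suc (k * 2) * 3)
  sixfold = solve-∀
  residue : ∀ k → suc ((2 + k * 3) * 2) % 3 ≡ 2
  residue k = trans (cong (λ m → suc m % 3) (sixfold k)) ([m+kn]%n≡m%n 2 (suc (k * 2)) 3)

theorem5p7 : (n : ℕ) → 4 ≤ n → n % 14 ∈ 3 ∷ 5 ∷ 7 ∷ 9 ∷ 11 ∷ 13 ∷ [] →
    ∃ λ (D : GDD n 2 6 (7 * n) (8 * (n ∸ 1))) → HasConfiguration 2 4 D
theorem5p7 n 4≤n n%14∈ with n / 2 | n-odd
  where
  n-odd : n ≡ suc (n / 2 * 2)
  n-odd = trans (m≡m%n+[m/n]*n n 2) (cong (_+ n / 2 * 2)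
    -- As 2 divides 14, the parity of `n` is that of `n % 14`, and each listed residue is odd.
    (trans (sym (m∣n⇒o%n%m≡o%m 2 14 n (divides 7 refl)))
      (All.lookup {P = λ r → r % 2 ≡ 1} (refl ∷ refl ∷ refl ∷ refl ∷ refl ∷ refl ∷ []) n%14∈)))
... | h | refl = design , configuration
  where open Construction h (differenceFamily h 4≤n)
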